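{- Let $\Sigma$ be a signature on standard form over a variable system with the de Bruijn property, $F:\mathcal F_\Sigma\to\mathcal C$ a cwf morphism, $\Pi$ a predicate signature on standard form over $\Sigma$, and $\mathcal D$ a first-order hyperdoctrine over $\mathcal C$. Let $G:\mathcal H_{\Sigma,\Pi,\emptyset}\to\mathcal D$ be an $F$-based hyperdoctrine morphism, and $T$ a theory over $(\Sigma,\Pi)$ such that $G_\Gamma(\Gamma,\phi)\le G_\Gamma(\Gamma,\psi)$ for every sequent $(\phi\Rightarrow_\Gamma\psi)\in T$. Then $G_\Gamma(\Gamma,\phi)\le G_\Gamma(\Gamma,\psi)$ for every $(\phi\Rightarrow_\Gamma\psi)\in\mathrm{Thm}(\Sigma,\Pi,T)$; consequently $G$ (with the same components) is an $F$-based hyperdoctrine morphism $\mathcal H_{\Sigma,\Pi,T}\to\mathcal D$, i.e. a model of $T$.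
   Context: Type system: fix an infinite set $V$ of variables with decidable equality and a fresh variable provider: functions $\varphi,\mathsf{fr}$ assigning to each finite $X\subseteq V$ an inhabited $\varphi(X)\subseteq V\setminus X$ and $\mathsf{fr}(X)\in\varphi(X)$; de Bruijn property: $\varphi(X)=\{\mathsf{fr}(X)\}$. Disjoint sets $F$ (function symbols), $T$ (type symbols). Preelements: terms from variables and $F$; pretypes $S(t_1,\ldots,t_n)$, $S\in T$. $\mathrm V(E)$: variables of $E$; $E[\bar a/\bar x]$: simultaneous substitution. Precontext $\Gamma=x_1:A_1,\ldots,x_n:A_n$ with $x_k\in\varphi(\{x_1,\ldots,x_{k-1}\})$, $\mathrm V(A_k)\subseteq\{x_1,\ldots,x_{k-1}\}$; $\mathrm{OV}(\Gamma)=x_1,\ldots,x_n$; $\mathrm{Fresh}(\Gamma)=\varphi(\mathrm V(\Gamma))$, $\mathrm{fresh}(\Gamma)=\mathsf{fr}(\mathrm V(\Gamma))$; $E[\bar a/\Gamma]=E[\bar a/x_1,\ldots,x_n]$. Top variables $\mathrm{TV}(\langle\rangle)=\emptyset$, $\mathrm{TV}(\Gamma,x:A)=(\mathrm{TV}(\Gamma)\setminus\mathrm V(A))\cup\{x\}$; a determining sequence is a strictly increasing $\bar i=i_1,\ldots,i_k$ with $\mathrm{TV}(\Gamma)\subseteq\{x_{i_1},\ldots,x_{i_k}\}$, $\bar a_{\bar i}=a_{i_1},\ldots,a_{i_k}$; a declaration is on standard form if $\bar i=1,\ldots,n$ (then $\bar i$ is omitted). Declarations $(\Gamma,S,\bar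 i)$ and $(\Gamma,f,\bar i,U)$ ($\mathrm V(U)\subseteq\mathrm V(\Gamma)$), each symbol at most once. $\mathcal J(\Sigma)$: smallest set of judgements closed under (R1) $\langle\rangle$ context; (R2) $\Gamma$ context, $A$ type $(\Gamma)$ $\Rightarrow$ $\Gamma,x:A$ context ($x\in\mathrm{Fresh}(\Gamma)$); (R3) $x_1:A_1,\ldots,x_n:A_n$ context $\Rightarrow$ $x_i:A_i\ (x_1:A_1,\ldots,x_n:A_n)$; (R4) $(\Gamma,S,\bar i)\in\Sigma$, $\bar a:\Delta\to\Gamma$ $\Rightarrow$ $S(\bar a_{\bar i})$ type $(\Delta)$; (R5) $(\Gamma,f,\bar i,U)\in\Sigma$, $\bar a:\Delta\to\Gamma$, $U[\bar a/\Gamma]$ type $(\Delta)$ $\Rightarrow$ $f(\bar a_{\bar i}):U[\bar a/\Gamma]\ (\Delta)$; where "$\bar a:\Delta\to\Gamma$" abbreviates $\Delta$ context, $\Gamma$ context, $a_k:A_k[a_1,\ldots,a_{k-1}/x_1,\ldots,x_{k-1}]\ (\Delta)$. $\Sigma$ is a signature if declared contexts are contexts and declared $U$ are types in $\mathcal J(\Sigma)$. Cwf: a category $\mathcal C$ with terminal object; classes $\mathrm{Ty}(\Gamma)$ with functorial substitution $A\{f\}$; context extension $\Gamma.A$ with $\mathrm p(A):\Gamma.A\to\Gamma$; classes $\mathrm{Tm}(\Gamma,A)$ with functorial $a\{f\}\in\mathrm{Tm}(\Delta,A\{f\})$; $\mathrm v_A\in\mathrm{Tm}(\Gamma.A,A\{\mathrm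 p(A)\})$; $\langle f,a\rangle_A:\Delta\to\Gamma.A$ for $a\in\mathrm{Tm}(\Delta,A\{f\})$ with $\mathrm p(A)\langle f,a\rangle_A=f$, $\mathrm v_A\{\langle f,a\rangle_A\}=a$, $\langle\mathrm p(A)h,\mathrm v_A\{h\}\rangle_A=h$, $\langle f,a\rangle_A g=\langle fg,a\{g\}\rangle_A$; $f.A=\langle f\circ\mathrm p(A\{f\}),\mathrm v_{A\{f\}}\rangle_A:\Delta.A\{f\}\to\Gamma.A$. A cwf morphism $(F,\sigma,\theta):\mathcal C\to\mathcal C'$: a functor $F$ preserving the terminal object, $\sigma_\Gamma:\mathrm{Ty}(\Gamma)\to\mathrm{Ty}'(F\Gamma)$ with $\sigma_\Delta(A\{f\})=\sigma_\Gamma(A)\{Ff\}$, $F(\Gamma.A)=F\Gamma.\sigma_\Gamma(A)$, $F(\mathrm p(A))=\mathrm p(\sigma_\Gamma(A))$, and $\theta_{\Gamma,A}:\mathrm{Tm}(\Gamma,A)\to\mathrm{Tm}'(F\Gamma,\sigma_\Gamma(A))$ commuting with substitution, with $\theta(\mathrm v_A)=\mathrm v_{\sigma_\Gamma(A)}$ and $F\langle f,a\rangle_A=\langle Ff,\theta(a)\rangle_{\sigma_\Gamma(A)}$. The cwf $\mathcal F_\Sigma$: objects are contexts $\Gamma$ (i.e. ($\Gamma$ context)$\in\mathcal J(\Sigma)$); morphisms $(\Delta,\Gamma,\bar a)$ with $\bar a:\Delta\to\Gamma$ in $\mathcal J(\Sigma)$, composed by substitution, identity $(\Gamma,\Gamma,\mathrm{OV}(\Gamma))$;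 $\mathrm{Ty}(\Gamma)=\{(\Gamma,A):(A\text{ type }(\Gamma))\in\mathcal J(\Sigma)\}$, $(\Gamma,A)\{(\Delta,\Gamma,\bar a)\}=(\Delta,A[\bar a/\Gamma])$; $\mathrm{Tm}(\Gamma,(\Gamma,A))=\{((\Gamma,A),a):(a:A\ (\Gamma))\in\mathcal J(\Sigma)\}$; $\Gamma.(\Gamma,S)=\langle\Gamma,\mathrm{fresh}(\Gamma):S\rangle$, $\mathrm p=(\Gamma.(\Gamma,S),\Gamma,\mathrm{OV}(\Gamma))$, $\mathrm v=((\Gamma.(\Gamma,S),S),\mathrm{fresh}(\Gamma))$, $\langle(\Delta,\Gamma,\bar s),((\Delta,S[\bar s/\Gamma]),b)\rangle=(\Delta,\Gamma.(\Gamma,S),(\bar s,b))$. Heyting (pre)algebra: a preorder $\le$ (not necessarily antisymmetric) with $\top,\bot,\wedge,\vee,\to$ satisfying $\bot\le x\le\top$, $z\le x\wedge y$ iff $z\le x$ and $z\le y$, $x\vee y\le z$ iff $x\le z$ and $y\le z$, $z\le(x\to y)$ iff $z\wedge x\le y$; morphisms are monotone maps preserving the operations and constants. A first-order hyperdoctrine over a cwf $\mathcal C$ is $(\mathcal C,\mathrm{Pr},\forall,\exists)$ with $\mathrm{Pr}:\mathcal C^{\mathrm{op}}\to\mathrm{Heyting}$ a functor ($R\{f\}=\mathrm{Pr}(f)(R)$) and, for $S\in\mathrm{Ty}(\Gamma)$, monotone $\forall_S,\exists_S:\mathrm{Pr}(\Gamma.S)\to\mathrm{Pr}(\Gamma)$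 with $Q\le\forall_S(R)$ iff $Q\{\mathrm p(S)\}\le R$, and $\exists_S(R)\le Q$ iff $R\le Q\{\mathrm p(S)\}$ ($Q\in\mathrm{Pr}(\Gamma)$, $R\in\mathrm{Pr}(\Gamma.S)$), and for $f:\Delta\to\Gamma$: $\forall_S(R)\{f\}=\forall_{S\{f\}}(R\{f.S\})$, $\exists_S(R)\{f\}=\exists_{S\{f\}}(R\{f.S\})$. Given a cwf morphism $F=(F,\sigma,\theta):\mathcal C\to\mathcal C'$ and hyperdoctrines $\mathcal H=(\mathcal C,\mathrm{Pr},\forall,\exists)$, $\mathcal H'=(\mathcal C',\mathrm{Pr}',\forall',\exists')$, an $F$-based morphism $G:\mathcal H\to\mathcal H'$ is a family of Heyting morphisms $G_\Gamma:\mathrm{Pr}(\Gamma)\to\mathrm{Pr}'(F\Gamma)$ with $G_\Delta(R\{f\})=G_\Gamma(R)\{Ff\}$ for $f:\Delta\to\Gamma$, $G_\Gamma(\forall_S R)=\forall'_{\sigma_\Gamma(S)}(G_{\Gamma.S}R)$ and $G_\Gamma(\exists_S R)=\exists'_{\sigma_\Gamma(S)}(G_{\Gamma.S}R)$. Logic: predicate symbols from a set $P$ disjoint from $F\cup T$; a predicate declaration is $(\Gamma,\bar i,R)$ with ($\Gamma$ context)$\in\mathcal J(\Sigma)$, $\bar i$ determining, $R\in P$ (written $(\Gamma,R)$ on standard form); a predicate signature $\Pi$ declares each symbol at most once. $\mathrm{Form}(\Sigma,\Pi)$ is the smallest set of judgements "$\phi$ form $(\Gamma)$" with: $R(\bar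 a_{\bar i})$ form $(\Delta)$ for $(\Gamma,\bar i,R)\in\Pi$ and $\bar a:\Delta\to\Gamma$ in $\mathcal J(\Sigma)$; $\bot,\top$ form $(\Gamma)$ for contexts $\Gamma$; $(\phi\circ\psi)$ form $(\Gamma)$ for $\circ\in\{\wedge,\vee,\to\}$ from $\phi,\psi$ form $(\Gamma)$; $(Qx:A)\phi$ form $(\Gamma)$ for $Q\in\{\forall,\exists\}$ from $\phi$ form $(\Gamma,x:A)$ (with $(A\text{ type }(\Gamma))\in\mathcal J(\Sigma)$). Capture-avoiding substitution for $\bar a:\Delta\to\Gamma$: $\phi\{(\Delta,\Gamma,\bar a)\}=\phi[\bar a/\Gamma]$ for atomic $\phi$; it commutes with $\top,\bot,\wedge,\vee,\to$; and $((Qx:A)\theta)\{(\Delta,\Gamma,\bar a)\}=(Qy:A[\bar a/\Gamma])\,\theta\{(\langle\Delta,y:A[\bar a/\Gamma]\rangle,\langle\Gamma,x:A\rangle,(\bar a,y))\}$ with $y=\mathrm{fresh}(\Delta)$. A sequent is $\phi\Rightarrow_\Gamma\psi$ with $\phi,\psi$ form $(\Gamma)$; a theory is a set of sequents. Write $\mathbf p_\Gamma(x:A)=(\langle\Gamma,x:A\rangle,\Gamma,\mathrm{OV}(\Gamma))$. $\mathrm{Thm}(\Sigma,\Pi,T)$ is the smallest set of sequents containing $T$ and closed under: $\phi\Rightarrow_\Gamma\phi$; cut; $\theta\wedge\psi\Rightarrow_\Gamma\theta$, $\theta\wedge\psi\Rightarrow_\Gamma\psi$, from $\phi\Rightarrow_\Gamma\theta$,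 $\phi\Rightarrow_\Gamma\psi$ infer $\phi\Rightarrow_\Gamma\theta\wedge\psi$, $\phi\Rightarrow_\Gamma\top$; $\theta\Rightarrow_\Gamma\theta\vee\psi$, $\psi\Rightarrow_\Gamma\theta\vee\psi$, from $\theta\Rightarrow_\Gamma\phi$, $\psi\Rightarrow_\Gamma\phi$ infer $\theta\vee\psi\Rightarrow_\Gamma\phi$, $\bot\Rightarrow_\Gamma\phi$; $\theta\wedge\psi\Rightarrow_\Gamma\phi$ iff $\theta\Rightarrow_\Gamma\psi\to\phi$; $\phi\{\mathbf p_\Gamma(x:A)\}\Rightarrow_{\Gamma,x:A}\psi$ iff $\phi\Rightarrow_\Gamma(\forall x:A)\psi$; $\psi\Rightarrow_{\Gamma,x:A}\phi\{\mathbf p_\Gamma(x:A)\}$ iff $(\exists x:A)\psi\Rightarrow_\Gamma\phi$ (each "iff" read as two rules); and substitution: from $\phi\Rightarrow_\Gamma\psi$ and $\bar a:\Delta\to\Gamma$ infer $\phi\{(\Delta,\Gamma,\bar a)\}\Rightarrow_\Delta\psi\{(\Delta,\Gamma,\bar a)\}$. Lindenbaum–Tarski hyperdoctrine $\mathcal H_{\Sigma,\Pi,T}=(\mathcal F_\Sigma,\mathrm{Pr}_{\Sigma,\Pi,T},\forall,\exists)$: $\mathrm{Pr}_{\Sigma,\Pi,T}(\Gamma)=\{(\Gamma,\phi):(\phi\text{ form }(\Gamma))\in\mathrm{Form}(\Sigma,\Pi)\}$ ordered by $(\Gamma,\phi)\le(\Gamma,\psi)$ iff $(\phi\Rightarrow_\Gamma\psi)\in\mathrm{Thm}(\Sigma,\Pi,T)$,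 Heyting operations given by the connectives; $\mathrm{Pr}((\Delta,\Gamma,\bar a))(\Gamma,\phi)=(\Delta,\phi\{(\Delta,\Gamma,\bar a)\})$; $\forall_{(\Gamma,A)}(\langle\Gamma,x:A\rangle,\psi)=(\Gamma,(\forall x:A)\psi)$, $\exists_{(\Gamma,A)}(\langle\Gamma,x:A\rangle,\psi)=(\Gamma,(\exists x:A)\psi)$. $\mathcal H_{\Sigma,\Pi,\emptyset}$ is the case $T=\emptyset$; its underlying sets $\mathrm{Pr}(\Gamma)$ coincide with those of $\mathcal H_{\Sigma,\Pi,T}$. -}

module Defs where

open import Data.Empty using (⊥; ⊥-elim)
open import Data.Fin.Base using (Fin; _<_)
open import Data.List.Base as List using (List; []; _∷_; allFin; filter)
open import Data.List.Membership.Propositional using (_∈_; _∉_)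
import Data.List.Membership.DecPropositional as DecMembership
open import Data.List.Membership.Propositional.Properties using (∈-++⁺ˡ; ∈-++⁺ʳ)
open import Data.List.Relation.Binary.BagAndSetEquality using (_∼[_]_; set)
open import Data.List.Relation.Binary.Subset.Propositional using (_⊆_)
open import Data.List.Relation.Unary.All as All using (All; []; _∷_)
open import Data.List.Relation.Unary.All.Properties using () renaming (++⁺ to All-++⁺; ++⁻ˡ to All-++⁻ˡ; ++⁻ʳ to All-++⁻ʳ)
open import Data.List.Relation.Unary.Any using (here; there)
open import Data.List.Relation.Unary.Linked using (Linked)
open import Data.Nat.Base using (ℕ; zero; suc)
open import Data.Product.Base using (_×_; _,_; proj₁; proj₂)
open import Data.Sum.Base using (_⊎_; inj₁; inj₂)
open import Data.List.Relation.Unary.Unique.Propositional using (Unique; []; _∷_)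
import Data.List.Relation.Unary.Unique.DecPropositional as DecUnique
open import Data.List.Relation.Unary.Unique.Propositional.Properties using () renaming (++⁺ to Unique-++⁺)
import Data.Vec.Relation.Unary.All as VAllₘ
open import Data.Vec.Relation.Unary.All.Properties using (lookup⁺)
open import Data.Vec.Relation.Unary.All using ([]; _∷_) renaming (All to VAll)
open import Data.Unit.Base using (⊤; tt)
open import Data.Vec.Base as Vec using (Vec; []; _∷_; _∷ʳ_; toList; lookup)
open import Data.Vec.Properties as Vecₚ using (map-∷ʳ; toList-∷ʳ; lookup-map)
open import Function.Bundles using (_⇔_; mk⇔)
open import Level using (Level; _⊔_; 0ℓ) renaming (suc to lsuc)
open import Relation.Binary.Definitions using (DecidableEquality)
open import Relation.Binary.HeterogeneousEquality using (_≅_; refl)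
open import Relation.Binary.PropositionalEquality
  using (_≡_; _≢_; refl; sym; trans; cong; cong₂; subst; isEquivalence)
open import Relation.Binary.Structures using (IsPreorder)
open import Relation.Nullary using (Dec; yes; no; ¬?; _×-dec_; recompute)
open import Relation.Unary using (Pred)

-- Equality of objects, morphisms, types and elements is propositional
-- equality; _≅_ compares elements of families over provably equal indices,
-- and subst transports along such equalities where a law needs it.

record Cwf (o h t m : Level) : Set (lsuc (o ⊔ h ⊔ t ⊔ m)) where
  infixr 9 _∘_
  infixl 8 _▷_
  infixl 10 _[_]T _[_]t
  field
    Ob        : Set o
    Hom       : Ob → Ob → Set h
    id        : ∀ {Γ} → Hom Γ Γ
    _∘_       : ∀ {Θ Δ Γ} → Hom Δ Γ → Hom Θ Δ → Hom Θ Γ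
    identityˡ : ∀ {Δ Γ} (f : Hom Δ Γ) → id ∘ f ≡ f
    identityʳ : ∀ {Δ Γ} (f : Hom Δ Γ) → f ∘ id ≡ f
    assoc     : ∀ {Ξ Θ Δ Γ} (f : Hom Δ Γ) (g : Hom Θ Δ) (k : Hom Ξ Θ) →
                (f ∘ g) ∘ k ≡ f ∘ (g ∘ k)

    ◆        : Ob
    !        : ∀ Γ → Hom Γ ◆
    !-unique : ∀ {Γ} (f : Hom Γ ◆) → f ≡ ! Γ

    Ty    : Ob → Set t
    _[_]T : ∀ {Δ Γ} → Ty Γ → Hom Δ Γ → Ty Δ
    [id]T : ∀ {Γ} (A : Ty Γ) → A [ id ]T ≡ A
    [∘]T  : ∀ {Θ Δ Γ} (A : Ty Γ) (f : Hom Δ Γ) (g : Hom Θ Δ) →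
            A [ f ∘ g ]T ≡ A [ f ]T [ g ]T

    Tm    : (Γ : Ob) → Ty Γ → Set m
    _[_]t : ∀ {Δ Γ A} → Tm Γ A → (f : Hom Δ Γ) → Tm Δ (A [ f ]T)
    [id]t : ∀ {Γ A} (a : Tm Γ A) → a [ id ]t ≅ a
    [∘]t  : ∀ {Θ Δ Γ A} (a : Tm Γ A) (f : Hom Δ Γ) (g : Hom Θ Δ) →
            a [ f ∘ g ]t ≅ a [ f ]t [ g ]t

    _▷_     : (Γ : Ob) → Ty Γ → Ob
    p       : ∀ {Γ} (A : Ty Γ) → Hom (Γ ▷ A) Γ
    v       : ∀ {Γ} (A : Ty Γ) → Tm (Γ ▷ A) (A [ p A ]T)
    ⟨_∣_,_⟩ : ∀ {Δ Γ} (A : Ty Γ) (f : Hom Δ Γ) → Tm Δ (A [ f ]T) → Hom Δ (Γ ▷ A)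

    p-β    : ∀ {Δ Γ} (A : Ty Γ) (f : Hom Δ Γ) (a : Tm Δ (A [ f ]T)) →
             p A ∘ ⟨ A ∣ f , a ⟩ ≡ f
    v-β    : ∀ {Δ Γ} (A : Ty Γ) (f : Hom Δ Γ) (a : Tm Δ (A [ f ]T)) →
             v A [ ⟨ A ∣ f , a ⟩ ]t ≅ a
    pair-η : ∀ {Δ Γ} (A : Ty Γ) (k : Hom Δ (Γ ▷ A)) →
             ⟨ A ∣ p A ∘ k , subst (Tm Δ) (sym ([∘]T A (p A) k)) (v A [ k ]t) ⟩ ≡ k
    pair-∘ : ∀ {Θ Δ Γ} (A : Ty Γ) (f : Hom Δ Γ) (a : Tm Δ (A [ f ]T)) (g : Hom Θ Δ) →
             ⟨ A ∣ f , a ⟩ ∘ g ≡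
             ⟨ A ∣ f ∘ g , subst (Tm Θ) (sym ([∘]T A f g)) (a [ g ]t) ⟩

  -- The morphism written f.A in the literature.
  _↑_ : ∀ {Δ Γ} (f : Hom Δ Γ) (A : Ty Γ) → Hom (Δ ▷ A [ f ]T) (Γ ▷ A)
  f ↑ A = ⟨ A ∣ f ∘ p (A [ f ]T)
              , subst (Tm _) (sym ([∘]T A f (p (A [ f ]T)))) (v (A [ f ]T)) ⟩

record CwfMorphism {o h t m o′ h′ t′ m′ : Level}
                   (𝒞 : Cwf o h t m) (𝒞′ : Cwf o′ h′ t′ m′)
                   : Set (o ⊔ h ⊔ t ⊔ m ⊔ o′ ⊔ h′ ⊔ t′ ⊔ m′) where
  private
    module C = Cwf 𝒞
    module D = Cwf 𝒞′
  field
    F₀   : C.Ob → D.Ob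
    F₁   : ∀ {Δ Γ} → C.Hom Δ Γ → D.Hom (F₀ Δ) (F₀ Γ)
    F-id : ∀ {Γ} → F₁ (C.id {Γ}) ≡ D.id
    F-∘  : ∀ {Θ Δ Γ} (f : C.Hom Δ Γ) (g : C.Hom Θ Δ) → F₁ (f C.∘ g) ≡ F₁ f D.∘ F₁ g
    F-◆  : F₀ C.◆ ≡ D.◆

    σ      : ∀ {Γ} → C.Ty Γ → D.Ty (F₀ Γ)
    σ-[]   : ∀ {Δ Γ} (A : C.Ty Γ) (f : C.Hom Δ Γ) → σ (A C.[ f ]T) ≡ σ A D.[ F₁ f ]T
    F-▷    : ∀ {Γ} (A : C.Ty Γ) → F₀ (Γ C.▷ A) ≡ F₀ Γ D.▷ σ A
    F-p    : ∀ {Γ} (A : C.Ty Γ) → F₁ (C.p A) ≅ D.p (σ A)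

    θ      : ∀ {Γ} {A : C.Ty Γ} → C.Tm Γ A → D.Tm (F₀ Γ) (σ A)
    θ-[]   : ∀ {Δ Γ} {A : C.Ty Γ} (a : C.Tm Γ A) (f : C.Hom Δ Γ) →
             θ (a C.[ f ]t) ≅ θ a D.[ F₁ f ]t
    θ-v    : ∀ {Γ} (A : C.Ty Γ) → θ (C.v A) ≅ D.v (σ A)
    F-pair : ∀ {Δ Γ} (A : C.Ty Γ) (f : C.Hom Δ Γ) (a : C.Tm Δ (A C.[ f ]T)) →
             F₁ C.⟨ A ∣ f , a ⟩ ≅
             D.⟨ σ A ∣ F₁ f , subst (D.Tm (F₀ Δ)) (σ-[] A f) (θ a) ⟩

-- The order need not be antisymmetric, and morphisms preserve the
-- operations up to equality of elements, not merely up to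
-- order-equivalence; this rules out the lattices of Relation.Binary.Lattice.

record Heyting (c ℓ : Level) : Set (lsuc (c ⊔ ℓ)) where
  infix  4 _≤_
  infixr 7 _∧_
  infixr 6 _∨_
  infixr 5 _⇒_
  field
    Carrier     : Set c
    _≤_         : Carrier → Carrier → Set ℓ
    isPreorder  : IsPreorder _≡_ _≤_
    ⊤′ ⊥′       : Carrier
    _∧_ _∨_ _⇒_ : Carrier → Carrier → Carrier
    ⊥-min       : ∀ x → ⊥′ ≤ x
    ⊤-max       : ∀ x → x ≤ ⊤′
    ∧-glb       : ∀ x y z → z ≤ x ∧ y ⇔ (z ≤ x × z ≤ y)
    ∨-lub       : ∀ x y z → x ∨ y ≤ z ⇔ (x ≤ z × y ≤ z)
    ⇒-adj       : ∀ x y z → z ≤ (x ⇒ y) ⇔ z ∧ x ≤ y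

record IsHeytingMorphism {c ℓ c′ ℓ′ : Level} (H : Heyting c ℓ) (K : Heyting c′ ℓ′)
                         (h : Heyting.Carrier H → Heyting.Carrier K)
                         : Set (c ⊔ ℓ ⊔ c′ ⊔ ℓ′) where
  private
    module H = Heyting H
    module K = Heyting K
  field
    monotone : ∀ {x y} → x H.≤ y → h x K.≤ h y
    pres-⊤   : h H.⊤′ ≡ K.⊤′
    pres-⊥   : h H.⊥′ ≡ K.⊥′
    pres-∧   : ∀ x y → h (x H.∧ y) ≡ h x K.∧ h y
    pres-∨   : ∀ x y → h (x H.∨ y) ≡ h x K.∨ h y
    pres-⇒   : ∀ x y → h (x H.⇒ y) ≡ (h x K.⇒ h y)

record Hyperdoctrine {o h t m : Level} (𝒞 : Cwf o h t m) (c ℓ : Level)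
                     : Set (o ⊔ h ⊔ t ⊔ m ⊔ lsuc (c ⊔ ℓ)) where
  open Cwf 𝒞
  infixl 10 _[_]P
  field
    Pr : Ob → Heyting c ℓ

  ∣Pr∣ : Ob → Set c
  ∣Pr∣ Γ = Heyting.Carrier (Pr Γ)

  infix 4 _≤_
  _≤_ : ∀ {Γ} → ∣Pr∣ Γ → ∣Pr∣ Γ → Set ℓ
  _≤_ {Γ} = Heyting._≤_ (Pr Γ)

  field
    _[_]P    : ∀ {Δ Γ} → ∣Pr∣ Γ → Hom Δ Γ → ∣Pr∣ Δ
    []P-mor  : ∀ {Δ Γ} (f : Hom Δ Γ) → IsHeytingMorphism (Pr Γ) (Pr Δ) (_[ f ]P)
    [id]P    : ∀ {Γ} (R : ∣Pr∣ Γ) → R [ id ]P ≡ R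
    [∘]P     : ∀ {Θ Δ Γ} (R : ∣Pr∣ Γ) (f : Hom Δ Γ) (g : Hom Θ Δ) →
               R [ f ∘ g ]P ≡ R [ f ]P [ g ]P

    ∀′ ∃′    : ∀ {Γ} (S : Ty Γ) → ∣Pr∣ (Γ ▷ S) → ∣Pr∣ Γ
    ∀-mono   : ∀ {Γ} (S : Ty Γ) {R R′} → R ≤ R′ → ∀′ S R ≤ ∀′ S R′
    ∃-mono   : ∀ {Γ} (S : Ty Γ) {R R′} → R ≤ R′ → ∃′ S R ≤ ∃′ S R′
    ∀-adj    : ∀ {Γ} (S : Ty Γ) Q R → Q ≤ ∀′ S R ⇔ Q [ p S ]P ≤ R
    ∃-adj    : ∀ {Γ} (S : Ty Γ) Q R → ∃′ S R ≤ Q ⇔ R ≤ Q [ p S ]P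
    ∀-[]     : ∀ {Δ Γ} (S : Ty Γ) R (f : Hom Δ Γ) →
               ∀′ S R [ f ]P ≡ ∀′ (S [ f ]T) (R [ f ↑ S ]P)
    ∃-[]     : ∀ {Δ Γ} (S : Ty Γ) R (f : Hom Δ Γ) →
               ∃′ S R [ f ]P ≡ ∃′ (S [ f ]T) (R [ f ↑ S ]P)

module _ {o h t m o′ h′ t′ m′ c ℓ c′ ℓ′ : Level}
         {𝒞 : Cwf o h t m} {𝒞′ : Cwf o′ h′ t′ m′} (𝐅 : CwfMorphism 𝒞 𝒞′)
         (ℋ : Hyperdoctrine 𝒞 c ℓ) (ℋ′ : Hyperdoctrine 𝒞′ c′ ℓ′) where
  private
    module C = Cwf 𝒞
    module F = CwfMorphism 𝐅
    module H = Hyperdoctrine ℋ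
    module K = Hyperdoctrine ℋ′

  record IsHyperdoctrineMorphism (G : ∀ Γ → H.∣Pr∣ Γ → K.∣Pr∣ (F.F₀ Γ))
                                 : Set (o ⊔ h ⊔ t ⊔ c ⊔ ℓ ⊔ c′ ⊔ ℓ′) where
    field
      heyting : ∀ Γ → IsHeytingMorphism (H.Pr Γ) (K.Pr (F.F₀ Γ)) (G Γ)
      natural : ∀ {Δ Γ} (R : H.∣Pr∣ Γ) (f : C.Hom Δ Γ) →
                G Δ (R H.[ f ]P) ≡ G Γ R K.[ F.F₁ f ]P
      pres-∀  : ∀ {Γ} (S : C.Ty Γ) (R : H.∣Pr∣ (Γ C.▷ S)) →
                G Γ (H.∀′ S R) ≡
                K.∀′ (F.σ S) (subst K.∣Pr∣ (F.F-▷ S) (G (Γ C.▷ S) R))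
      pres-∃  : ∀ {Γ} (S : C.Ty Γ) (R : H.∣Pr∣ (Γ C.▷ S)) →
                G Γ (H.∃′ S R) ≡
                K.∃′ (F.σ S) (subst K.∣Pr∣ (F.F-▷ S) (G (Γ C.▷ S) R))

  record HyperdoctrineMorphism : Set (o ⊔ h ⊔ t ⊔ c ⊔ ℓ ⊔ c′ ⊔ ℓ′) where
    field
      G          : ∀ Γ → H.∣Pr∣ Γ → K.∣Pr∣ (F.F₀ Γ)
      isMorphism : IsHyperdoctrineMorphism G

-- Finite sets of variables are lists considered up to having the same
-- members.  The infinity of V follows from fr∈φ and φ-fresh.

record VariableSystem : Set₁ where
  infix 4 _≟_
  field
    V       : Set
    _≟_     : DecidableEquality V
    φ       : List V → Pred V 0ℓ
    fr      : List V → V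
    φ-cong  : ∀ {X Y} → X ∼[ set ] Y → ∀ {x} → φ X x → φ Y x
    fr-cong : ∀ {X Y} → X ∼[ set ] Y → fr X ≡ fr Y
    φ-fresh : ∀ {X x} → φ X x → x ∉ X
    fr∈φ    : ∀ X → φ X (fr X)

DeBruijn : VariableSystem → Set
DeBruijn 𝕍 = ∀ {X x} → φ X x → x ≡ fr X
  where open VariableSystem 𝕍

module Syntax (𝕍 : VariableSystem) (F T : Set) where
  open VariableSystem 𝕍
  open DecMembership _≟_ using (_∈?_)

  data Term : Set where
    var : V → Term
    app : F → List Term → Term

  data Pretype : Set where
    con : T → List Term → Pretype

  vars  : Term → List V
  vars* : List Term → List V
  vars (var x)    = x ∷ []
  vars (app f ts) = vars* ts
  vars* []        = []
  vars* (t ∷ ts)  = vars t List.++ vars* ts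

  varsᵀ : Pretype → List V
  varsᵀ (con S ts) = vars* ts

  infixl 10 _⟨_/_⟩ _⟨_/_⟩* _⟨_/_⟩ᵀ

  substVar : ∀ {n} → V → Vec Term n → Vec V n → Term
  substVar y []       []       = var y
  substVar y (a ∷ as) (x ∷ xs) with y ≟ x
  ... | yes _ = a
  ... | no  _ = substVar y as xs

  _⟨_/_⟩  : ∀ {n} → Term → Vec Term n → Vec V n → Term
  _⟨_/_⟩* : ∀ {n} → List Term → Vec Term n → Vec V n → List Term
  var y    ⟨ as / xs ⟩  = substVar y as xs
  app f ts ⟨ as / xs ⟩  = app f (ts ⟨ as / xs ⟩*)
  []       ⟨ as / xs ⟩* = []
  (t ∷ ts) ⟨ as / xs ⟩* = t ⟨ as / xs ⟩ ∷ ts ⟨ as / xs ⟩*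

  _⟨_/_⟩ᵀ : ∀ {n} → Pretype → Vec Term n → Vec V n → Pretype
  con S ts ⟨ as / xs ⟩ᵀ = con S (ts ⟨ as / xs ⟩*)

  infixl 6 _▸_∶_

  -- Sequences of typed variables; IsPrecontext carves out the precontexts.
  data Cx : Set where
    ε     : Cx
    _▸_∶_ : Cx → V → Pretype → Cx

  ∣_∣ : Cx → ℕ
  ∣ ε ∣         = zero
  ∣ Γ ▸ x ∶ A ∣ = suc ∣ Γ ∣

  OV : (Γ : Cx) → Vec V ∣ Γ ∣
  OV ε           = []
  OV (Γ ▸ x ∶ A) = OV Γ ∷ʳ x

  -- The set V(Γ).  In a precontext every variable of a type has been
  -- declared before, so the declared variables are all of them.
  varsᶜ : Cx → List V
  varsᶜ Γ = toList (OV Γ)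

  data IsPrecontext : Cx → Set where
    ε   : IsPrecontext ε
    ext : ∀ {Γ x A} → IsPrecontext Γ → φ (varsᶜ Γ) x → varsᵀ A ⊆ varsᶜ Γ →
          IsPrecontext (Γ ▸ x ∶ A)

  Fresh : Cx → Pred V 0ℓ
  Fresh Γ = φ (varsᶜ Γ)

  fresh : Cx → V
  fresh Γ = fr (varsᶜ Γ)

  -- Positions are counted from 0.
  Indices : Cx → Set
  Indices Γ = List (Fin ∣ Γ ∣)

  -- The subsequence ā_ī.
  infixl 9 _‼_
  _‼_ : ∀ {A : Set} {n} → Vec A n → List (Fin n) → List A
  as ‼ is = List.map (lookup as) is

  TV : Cx → List V
  TV ε           = []
  TV (Γ ▸ x ∶ A) = x ∷ filter (λ y → ¬? (y ∈? varsᵀ A)) (TV Γ)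

  Determining : (Γ : Cx) → Indices Γ → Set
  Determining Γ is = Linked _<_ is × TV Γ ⊆ OV Γ ‼ is

  data Declaration : Set where
    typeDecl : (Γ : Cx) (S : T) (is : Indices Γ) → Declaration
    funDecl  : (Γ : Cx) (f : F) (is : Indices Γ) (U : Pretype) → Declaration

  symbol : Declaration → T ⊎ F
  symbol (typeDecl Γ S is)   = inj₁ S
  symbol (funDecl Γ f is U) = inj₂ f

  WellFormed : Declaration → Set
  WellFormed (typeDecl Γ S is)   = IsPrecontext Γ × Determining Γ is
  WellFormed (funDecl Γ f is U) = IsPrecontext Γ × Determining Γ is × varsᵀ U ⊆ varsᶜ Γ

  OnStandardForm : Declaration → Set
  OnStandardForm (typeDecl Γ S is)   = is ≡ allFin ∣ Γ ∣
  OnStandardForm (funDecl Γ f is U) = is ≡ allFin ∣ Γ ∣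

  record Presignature : Set₁ where
    field
      declares   : Pred Declaration 0ℓ
      wellFormed : ∀ {d} → declares d → WellFormed d
      unique     : ∀ {d d′} → declares d → declares d′ → symbol d ≡ symbol d′ → d ≡ d′

  infix 3 _ctx _type_ _∶_over_

  data Judgement : Set where
    _ctx     : Cx → Judgement
    _type_   : Pretype → Cx → Judgement
    _∶_over_ : Term → Pretype → Cx → Judgement

  data _∶_∈ᶜ_ : V → Pretype → Cx → Set where
    here  : ∀ {Γ x A} → x ∶ A ∈ᶜ (Γ ▸ x ∶ A)
    there : ∀ {Γ x A y B} → x ∶ A ∈ᶜ Γ → x ∶ A ∈ᶜ (Γ ▸ y ∶ B)

  infix 4 _∶_∈ᶜ_

  module Derivability (Sg : Presignature) where
    open Presignature Sg

    infix 4 _⟶_∋_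

    -- J is the set of derivable judgements.  An element of Δ ⟶ Γ ∋ as
    -- consists of derivations of the judgements abbreviated by ā : Δ → Γ.
    data J : Judgement → Set
    data _⟶_∋_ (Δ Γ : Cx) (as : Vec Term ∣ Γ ∣) : Set
    data Components (Δ : Cx) : (Γ : Cx) → Vec Term ∣ Γ ∣ → Set

    data J where
      emp : J (ε ctx)
      ext : ∀ {Γ x A} → J (Γ ctx) → J (A type Γ) → Fresh Γ x →
            J ((Γ ▸ x ∶ A) ctx)
      var : ∀ {Γ x A} → J (Γ ctx) → x ∶ A ∈ᶜ Γ → J (var x ∶ A over Γ)
      con : ∀ {Γ S is Δ as} → declares (typeDecl Γ S is) → Δ ⟶ Γ ∋ as →
            J (con S (as ‼ is) type Δ)
      app : ∀ {Γ f is U Δ as} → declares (funDecl Γ f is U) → Δ ⟶ Γ ∋ as →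
            J ((U ⟨ as / OV Γ ⟩ᵀ) type Δ) →
            J (app f (as ‼ is) ∶ U ⟨ as / OV Γ ⟩ᵀ over Δ)

    data _⟶_∋_ Δ Γ as where
      mor : J (Δ ctx) → J (Γ ctx) → Components Δ Γ as → Δ ⟶ Γ ∋ as

    data Components Δ where
      []  : Components Δ ε []
      _,_ : ∀ {Γ x A as a} → Components Δ Γ as →
            J (a ∶ A ⟨ as / OV Γ ⟩ᵀ over Δ) →
            Components Δ (Γ ▸ x ∶ A) (as ∷ʳ a)

  Valid : Presignature → Declaration → Set
  Valid Sg (typeDecl Γ S is)   = J (Γ ctx)
    where open Derivability Sg
  Valid Sg (funDecl Γ f is U) = J (Γ ctx) × J (U type Γ)
    where open Derivability Sg

  record Signature : Set₁ where
    field
      presignature : Presignature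
    open Presignature presignature public
    open Derivability presignature public
    field
      valid : ∀ {d} → declares d → Valid presignature d

  StandardForm : Signature → Set
  StandardForm Sg = ∀ {d} → declares d → OnStandardForm d
    where open Signature Sg

  infix 4 _inScope_ _inScope*_ _inScopeᵀ_ _inScopeᵛ_

  _inScope_ : Term → List V → Set
  t inScope X = All (_∈ X) (vars t)

  _inScope*_ : List Term → List V → Set
  ts inScope* X = All (_∈ X) (vars* ts)

  _inScopeᵀ_ : Pretype → List V → Set
  A inScopeᵀ X = All (_∈ X) (varsᵀ A)

  _inScopeᵛ_ : ∀ {n} → Vec Term n → List V → Set
  as inScopeᵛ X = VAll (_inScope X) as

  inScopeᵀ? : ∀ A X → Dec (A inScopeᵀ X)
  inScopeᵀ? A X = All.all? (_∈? X) (varsᵀ A)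

  inScope? : ∀ t X → Dec (t inScope X)
  inScope? t X = All.all? (_∈? X) (vars t)

  inScopeᵛ? : ∀ {n} (as : Vec Term n) X → Dec (as inScopeᵛ X)
  inScopeᵛ? as X = VAllₘ.all? (λ a → inScope? a X) as

  ∈-∷ʳ⁺ˡ : ∀ {n y} (xs : Vec V n) x → y ∈ toList xs → y ∈ toList (xs ∷ʳ x)
  ∈-∷ʳ⁺ˡ xs x y∈ = subst (_ ∈_) (sym (toList-∷ʳ x xs)) (∈-++⁺ˡ y∈)

  ∈-∷ʳ⁺ʳ : ∀ {n} (xs : Vec V n) x → x ∈ toList (xs ∷ʳ x)
  ∈-∷ʳ⁺ʳ xs x = subst (_ ∈_) (sym (toList-∷ʳ x xs)) (∈-++⁺ʳ (toList xs) (here refl))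

  VAll-∷ʳ : ∀ {n} {Q : Term → Set} {as : Vec Term n} {a} → VAll Q as → Q a → VAll Q (as ∷ʳ a)
  VAll-∷ʳ []       q = q ∷ []
  VAll-∷ʳ (r ∷ rs) q = r ∷ VAll-∷ʳ rs q

  map-congᵛ : ∀ {n} {Q : Term → Set} {f g : Term → Term} {as : Vec Term n} →
              (∀ {a} → Q a → f a ≡ g a) → VAll Q as → Vec.map f as ≡ Vec.map g as
  map-congᵛ eq []       = refl
  map-congᵛ eq (q ∷ qs) = cong₂ _∷_ (eq q) (map-congᵛ eq qs)

  inScopeᵛ-‼ : ∀ {n X} {as : Vec Term n} → as inScopeᵛ X → ∀ is → as ‼ is inScope* X
  inScopeᵛ-‼ s []       = []
  inScopeᵛ-‼ s (i ∷ is) = All-++⁺ (lookup⁺ s i) (inScopeᵛ-‼ s is)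

  substVar-∷ʳ : ∀ {n y} (xs : Vec V n) (as : Vec Term n) {x a} → y ∈ toList xs →
                substVar y (as ∷ʳ a) (xs ∷ʳ x) ≡ substVar y as xs
  substVar-∷ʳ {y = y} (x ∷ xs) (a ∷ as) y∈ with y ≟ x
  ... | yes _ = refl
  substVar-∷ʳ (x ∷ xs) (a ∷ as) (here y≡x) | no y≢x = ⊥-elim (y≢x y≡x)
  substVar-∷ʳ (x ∷ xs) (a ∷ as) (there y∈) | no _   = substVar-∷ʳ xs as y∈

  substVar-last : ∀ {n} (xs : Vec V n) (as : Vec Term n) {x a} → x ∉ toList xs →
                  substVar x (as ∷ʳ a) (xs ∷ʳ x) ≡ a
  substVar-last [] [] {x} x∉ with x ≟ x
  ... | yes _  = refl
  ... | no x≢x = ⊥-elim (x≢x refl)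
  substVar-last (y ∷ xs) (a ∷ as) {x} x∉ with x ≟ y
  ... | yes x≡y = ⊥-elim (x∉ (here x≡y))
  ... | no _    = substVar-last xs as (λ x∈ → x∉ (there x∈))

  substVar-id : ∀ {n} y (xs : Vec V n) → substVar y (Vec.map var xs) xs ≡ var y
  substVar-id y [] = refl
  substVar-id y (x ∷ xs) with y ≟ x
  ... | yes y≡x = cong var (sym y≡x)
  ... | no _    = substVar-id y xs

  substVar-map : ∀ {n y} {f : Term → Term} (xs : Vec V n) as → y ∈ toList xs →
                 substVar y (Vec.map f as) xs ≡ f (substVar y as xs)
  substVar-map {y = y} (x ∷ xs) (a ∷ as) y∈ with y ≟ x
  ... | yes _ = refl
  substVar-map (x ∷ xs) (a ∷ as) (here y≡x) | no y≢x = ⊥-elim (y≢x y≡x)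
  substVar-map (x ∷ xs) (a ∷ as) (there y∈) | no _   = substVar-map xs as y∈

  subst-cong : ∀ {n m} {as : Vec Term n} {xs} {bs : Vec Term m} {ys} t →
               All (λ y → substVar y as xs ≡ substVar y bs ys) (vars t) →
               t ⟨ as / xs ⟩ ≡ t ⟨ bs / ys ⟩
  subst-cong* : ∀ {n m} {as : Vec Term n} {xs} {bs : Vec Term m} {ys} ts →
                All (λ y → substVar y as xs ≡ substVar y bs ys) (vars* ts) →
                ts ⟨ as / xs ⟩* ≡ ts ⟨ bs / ys ⟩*
  subst-cong (var x)    (e ∷ []) = e
  subst-cong (app f ts) es       = cong (app f) (subst-cong* ts es)
  subst-cong* []       es = refl
  subst-cong* (t ∷ ts) es =
    cong₂ _∷_ (subst-cong t (All-++⁻ˡ (vars t) es)) (subst-cong* ts (All-++⁻ʳ (vars t) es))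

  subst-id  : ∀ {n} {xs : Vec V n} t → t ⟨ Vec.map var xs / xs ⟩ ≡ t
  subst-id* : ∀ {n} {xs : Vec V n} ts → ts ⟨ Vec.map var xs / xs ⟩* ≡ ts
  subst-id {xs = xs} (var y) = substVar-id y xs
  subst-id (app f ts)        = cong (app f) (subst-id* ts)
  subst-id* []       = refl
  subst-id* (t ∷ ts) = cong₂ _∷_ (subst-id t) (subst-id* ts)

  subst-idᵀ : ∀ {n} {xs : Vec V n} A → A ⟨ Vec.map var xs / xs ⟩ᵀ ≡ A
  subst-idᵀ (con S ts) = cong (con S) (subst-id* ts)

  subst-idᵛ : ∀ {n m} {xs : Vec V n} (as : Vec Term m) →
              Vec.map (_⟨ Vec.map var xs / xs ⟩) as ≡ as
  subst-idᵛ as = trans (Vecₚ.map-cong subst-id as) (Vecₚ.map-id as)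

  subst-∘  : ∀ {n m} {as : Vec Term n} {xs} {bs : Vec Term m} {ys} t →
             t inScope toList xs →
             t ⟨ as / xs ⟩ ⟨ bs / ys ⟩ ≡ t ⟨ Vec.map (_⟨ bs / ys ⟩) as / xs ⟩
  subst-∘* : ∀ {n m} {as : Vec Term n} {xs} {bs : Vec Term m} {ys} ts →
             ts inScope* toList xs →
             ts ⟨ as / xs ⟩* ⟨ bs / ys ⟩* ≡ ts ⟨ Vec.map (_⟨ bs / ys ⟩) as / xs ⟩*
  subst-∘ {as = as} {xs} {bs} {ys} (var x) (x∈ ∷ []) =
    sym (substVar-map {f = _⟨ bs / ys ⟩} xs as x∈)
  subst-∘ (app f ts) s = cong (app f) (subst-∘* ts s)
  subst-∘* []       s = refl
  subst-∘* (t ∷ ts) s =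
    cong₂ _∷_ (subst-∘ t (All-++⁻ˡ (vars t) s)) (subst-∘* ts (All-++⁻ʳ (vars t) s))

  subst-∘ᵀ : ∀ {n m} {as : Vec Term n} {xs} {bs : Vec Term m} {ys} A →
             A inScopeᵀ toList xs →
             A ⟨ as / xs ⟩ᵀ ⟨ bs / ys ⟩ᵀ ≡ A ⟨ Vec.map (_⟨ bs / ys ⟩) as / xs ⟩ᵀ
  subst-∘ᵀ (con S ts) s = cong (con S) (subst-∘* ts s)

  subst-∘ᵛ : ∀ {n m k} {as : Vec Term n} {xs} {bs : Vec Term m} {ys} (cs : Vec Term k) →
             cs inScopeᵛ toList xs →
             Vec.map (_⟨ bs / ys ⟩) (Vec.map (_⟨ as / xs ⟩) cs)
             ≡ Vec.map (_⟨ Vec.map (_⟨ bs / ys ⟩) as / xs ⟩) cs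
  subst-∘ᵛ cs s = trans (sym (Vecₚ.map-∘ _ _ cs)) (map-congᵛ (λ {a} → subst-∘ a) s)

  subst-∷ʳ : ∀ {n} {as : Vec Term n} {xs a x} t → t inScope toList xs →
             t ⟨ as ∷ʳ a / xs ∷ʳ x ⟩ ≡ t ⟨ as / xs ⟩
  subst-∷ʳ {as = as} {xs} {a} {x} t s = subst-cong t (All.map (substVar-∷ʳ xs as) s)

  subst-∷ʳᵀ : ∀ {n} {as : Vec Term n} {xs a x} A → A inScopeᵀ toList xs →
              A ⟨ as ∷ʳ a / xs ∷ʳ x ⟩ᵀ ≡ A ⟨ as / xs ⟩ᵀ
  subst-∷ʳᵀ {as = as} {xs} {a} {x} (con S ts) s = cong (con S) (subst-cong* ts (All.map (substVar-∷ʳ xs as) s))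

  subst-‼ : ∀ {n m} {bs : Vec Term m} {ys} (as : Vec Term n) is →
            (as ‼ is) ⟨ bs / ys ⟩* ≡ Vec.map (_⟨ bs / ys ⟩) as ‼ is
  subst-‼ as []       = refl
  subst-‼ as (i ∷ is) = cong₂ _∷_ (sym (lookup-map i _ as)) (subst-‼ as is)

  substVar-OV : ∀ {n} (xs : Vec V n) (as : Vec Term n) → Unique (toList xs) →
                Vec.map (_⟨ as / xs ⟩) (Vec.map var xs) ≡ as
  substVar-OV []       []       []        = refl
  substVar-OV (x ∷ xs) (a ∷ as) (x# ∷ us) = cong₂ _∷_ hd
    (trans (tl xs x#) (substVar-OV xs as us))
    where
    hd : substVar x (a ∷ as) (x ∷ xs) ≡ a
    hd with x ≟ x
    ... | yes _  = refl
    ... | no x≢x = ⊥-elim (x≢x refl)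
    tl : ∀ {k} (ys : Vec V k) → All (x ≢_) (toList ys) →
         Vec.map (_⟨ a ∷ as / x ∷ xs ⟩) (Vec.map var ys)
         ≡ Vec.map (_⟨ as / xs ⟩) (Vec.map var ys)
    tl []       []        = refl
    tl (y ∷ ys) (x≢y ∷ n) with y ≟ x
    ... | yes y≡x = ⊥-elim (x≢y (sym y≡x))
    ... | no _    = cong (_ ∷_) (tl ys n)

  substVar-p : ∀ {n} (xs : Vec V n) (as : Vec Term n) {x a} → Unique (toList xs) →
               Vec.map (_⟨ as ∷ʳ a / xs ∷ʳ x ⟩) (Vec.map var xs) ≡ as
  substVar-p xs as u = trans (map-congᵛ (λ {t} → subst-∷ʳ t) (sc xs (λ y∈ → y∈))) (substVar-OV xs as u)
    where
    sc : ∀ {k X} (ys : Vec V k) → (∀ {y} → y ∈ toList ys → y ∈ X) → Vec.map var ys inScopeᵛ X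
    sc []       f = []
    sc (y ∷ ys) f = (f (here refl) ∷ []) ∷ sc ys (λ y∈ → f (there y∈))

  module Contexts (Sg : Signature) where
    open Signature Sg

    ∈ᶜ⇒∈ : ∀ {x A Γ} → x ∶ A ∈ᶜ Γ → x ∈ varsᶜ Γ
    ∈ᶜ⇒∈ (here {Γ})     = ∈-∷ʳ⁺ʳ (OV Γ) _
    ∈ᶜ⇒∈ (there {Γ} x∈) = ∈-∷ʳ⁺ˡ (OV Γ) _ (∈ᶜ⇒∈ x∈)

    inScope-type : ∀ {A Γ} → J (A type Γ) → A inScopeᵀ varsᶜ Γ
    inScope-elem : ∀ {a A Γ} → J (a ∶ A over Γ) → a inScope varsᶜ Γ
    inScope-comp : ∀ {Δ Γ as} → Components Δ Γ as → as inScopeᵛ varsᶜ Δ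
    inScope-mor  : ∀ {Δ Γ as} → Δ ⟶ Γ ∋ as → as inScopeᵛ varsᶜ Δ
    inScope-type (con {is = is} d m) = inScopeᵛ-‼ (inScope-mor m) is
    inScope-elem (var c x∈)          = ∈ᶜ⇒∈ x∈ ∷ []
    inScope-elem (app {is = is} d m u) = inScopeᵛ-‼ (inScope-mor m) is
    inScope-comp []       = []
    inScope-comp (as , a) = VAll-∷ʳ (inScope-comp as) (inScope-elem a)
    inScope-mor (mor _ _ as) = inScope-comp as

    ∈ᶜ-inScope : ∀ {x A Γ} → J (Γ ctx) → x ∶ A ∈ᶜ Γ → A inScopeᵀ varsᶜ Γ
    ∈ᶜ-inScope {Γ = Γ ▸ _ ∶ _} (ext c a f) here       = All.map (∈-∷ʳ⁺ˡ (OV Γ) _) (inScope-type a)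
    ∈ᶜ-inScope {Γ = Γ ▸ _ ∶ _} (ext c a f) (there x∈) = All.map (∈-∷ʳ⁺ˡ (OV Γ) _) (∈ᶜ-inScope c x∈)

    OV-unique : ∀ {Γ} → J (Γ ctx) → Unique (varsᶜ Γ)
    OV-unique emp = []
    OV-unique {Γ ▸ x ∶ A} (ext c a f) = subst Unique (sym (toList-∷ʳ x (OV Γ)))
      (Unique-++⁺ (OV-unique c) ([] ∷ []) λ { (y∈ , here refl) → φ-fresh f y∈ })

    comp-lookup : ∀ {Δ Γ as x A} → J (Γ ctx) → Components Δ Γ as → x ∶ A ∈ᶜ Γ →
                  J (substVar x as (OV Γ) ∶ A ⟨ as / OV Γ ⟩ᵀ over Δ)
    comp-lookup {Δ} {Γ ▸ x ∶ A} (ext c t f) (_,_ {as = as} {a = a} ms m) here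
      rewrite substVar-last (OV Γ) as {x} {a} (φ-fresh f)
            | subst-∷ʳᵀ {as = as} {OV Γ} {a} {x} A (inScope-type t) = m
    comp-lookup {Δ} {Γ ▸ y ∶ B} {A = A} (ext c t f) (_,_ {as = as} {a = a} ms m) (there x∈)
      rewrite substVar-∷ʳ (OV Γ) as {y} {a} (∈ᶜ⇒∈ x∈)
            | subst-∷ʳᵀ {as = as} {OV Γ} {a} {y} A (∈ᶜ-inScope c x∈) = comp-lookup c ms x∈

    subst-type : ∀ {Δ Γ as A} → Δ ⟶ Γ ∋ as → J (A type Γ) → J (A ⟨ as / OV Γ ⟩ᵀ type Δ)
    subst-elem : ∀ {Δ Γ as a A} → Δ ⟶ Γ ∋ as → J (a ∶ A over Γ) →
                 J (a ⟨ as / OV Γ ⟩ ∶ A ⟨ as / OV Γ ⟩ᵀ over Δ)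
    subst-comp : ∀ {Δ Γ Θ as bs} → Δ ⟶ Γ ∋ as → J (Θ ctx) → Components Γ Θ bs →
                 Components Δ Θ (Vec.map (_⟨ as / OV Γ ⟩) bs)
    subst-mor  : ∀ {Δ Γ Θ as bs} → Δ ⟶ Γ ∋ as → Γ ⟶ Θ ∋ bs →
                 Δ ⟶ Θ ∋ Vec.map (_⟨ as / OV Γ ⟩) bs
    subst-type {Δ} {Γ} {as} m (con {is = is} {as = bs} d n) =
      subst (λ ts → J (con _ ts type Δ)) (sym (subst-‼ bs is)) (con d (subst-mor m n))
    subst-elem (mor _ c ms) (var _ x∈) = comp-lookup c ms x∈
    subst-elem {Δ} {Γ} {as} m (app {Γ = Θ} {is = is} {U} {as = bs} d n u) =
      subst (λ ts → J (app _ ts ∶ U ⟨ bs / OV Θ ⟩ᵀ ⟨ as / OV Γ ⟩ᵀ over Δ)) (sym (subst-‼ bs is))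
        (subst (λ B → J (app _ _ ∶ B over Δ)) (sym eq)
          (app d (subst-mor m n) (subst (λ B → J (B type Δ)) eq (subst-type m u))))
      where
      eq : U ⟨ bs / OV Θ ⟩ᵀ ⟨ as / OV Γ ⟩ᵀ ≡ U ⟨ Vec.map (_⟨ as / OV Γ ⟩) bs / OV Θ ⟩ᵀ
      eq = subst-∘ᵀ U (inScope-type (proj₂ (valid d)))
    subst-comp m c [] = []
    subst-comp {Δ} {Γ} {as = as} m (ext {Θ} {x} {A} c t f) (_,_ {as = bs} {a = b} ns n) =
      subst (Components Δ (Θ ▸ x ∶ A)) (sym (map-∷ʳ (_⟨ as / OV Γ ⟩) b bs))
        (subst-comp m c ns
        , subst (λ B → J (_ ∶ B over Δ)) (subst-∘ᵀ A (inScope-type t)) (subst-elem m n))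
    subst-mor m@(mor d _ _) (mor _ c ns) = mor d c (subst-comp m c ns)

    var-comp : ∀ {Δ Γ} → J (Δ ctx) → J (Γ ctx) → (∀ {x A} → x ∶ A ∈ᶜ Γ → x ∶ A ∈ᶜ Δ) →
               Components Δ Γ (Vec.map var (OV Γ))
    var-comp d emp inc = []
    var-comp {Δ} d (ext {Γ} {x} {A} c t f) inc =
      subst (Components Δ (Γ ▸ x ∶ A)) (sym (map-∷ʳ var x (OV Γ)))
        (var-comp d c (λ y∈ → inc (there y∈))
        , subst (λ B → J (var x ∶ B over Δ)) (sym (subst-idᵀ A)) (var d (inc here)))

    id-mor : ∀ {Γ} → J (Γ ctx) → Γ ⟶ Γ ∋ Vec.map var (OV Γ)
    id-mor c = mor c c (var-comp c c (λ x∈ → x∈))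

    p-mor : ∀ {Γ x A} → J ((Γ ▸ x ∶ A) ctx) → (Γ ▸ x ∶ A) ⟶ Γ ∋ Vec.map var (OV Γ)
    p-mor c@(ext c′ _ _) = mor c c′ (var-comp c c′ there)

    v-elem : ∀ {Γ x A} → J ((Γ ▸ x ∶ A) ctx) →
             J (var x ∶ A ⟨ Vec.map var (OV Γ) / OV Γ ⟩ᵀ over (Γ ▸ x ∶ A))
    v-elem {A = A} c = subst (λ B → J (_ ∶ B over _)) (sym (subst-idᵀ A)) (var c here)

    pair-mor : ∀ {Δ Γ x A as a} → J ((Γ ▸ x ∶ A) ctx) → Δ ⟶ Γ ∋ as →
               J (a ∶ A ⟨ as / OV Γ ⟩ᵀ over Δ) → Δ ⟶ (Γ ▸ x ∶ A) ∋ (as ∷ʳ a)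
    pair-mor c′ (mor d c ms) m = mor d c′ (ms , m)

    dom : ∀ {Δ Γ as} → Δ ⟶ Γ ∋ as → J (Δ ctx)
    dom (mor d _ _) = d

    lift-mor : ∀ {Δ Γ as x A} → Δ ⟶ Γ ∋ as → J ((Γ ▸ x ∶ A) ctx) →
               let y = fresh Δ in
               (Δ ▸ y ∶ A ⟨ as / OV Γ ⟩ᵀ) ⟶ (Γ ▸ x ∶ A) ∋ (as ∷ʳ var y)
    lift-mor {Δ} {Γ} {as} {x} {A} m@(mor d c _) c′@(ext _ t _)
      = mor d′ c′ (comps (subst-mor (p-mor d′) m) , var d′ here)
      where
      Δ′ : Cx
      Δ′ = Δ ▸ fresh Δ ∶ A ⟨ as / OV Γ ⟩ᵀ
      d′ : J (Δ′ ctx)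
      d′ = ext d (subst-type m t) (fr∈φ _)
      comps : Δ′ ⟶ Γ ∋ Vec.map (_⟨ Vec.map var (OV Δ) / OV Δ ⟩) as → Components Δ′ Γ as
      comps (mor _ _ ms) = subst (Components Δ′ Γ) (subst-idᵛ as) ms

    -- Derivations are irrelevant, so that contexts, morphisms, types and
    -- elements are equal as soon as their underlying expressions are.

    record Context : Set where
      constructor context
      field
        cx     : Cx
        .isCtx : J (cx ctx)
    open Context public using (cx)

    record Mor (Δ Γ : Context) : Set where
      constructor morphism
      field
        terms  : Vec Term ∣ cx Γ ∣
        .isMor : cx Δ ⟶ cx Γ ∋ terms
    open Mor public using (terms)

    record Type (Γ : Context) : Set where
      constructor ty
      field
        pretype : Pretype
        .isType : J (pretype type cx Γ)
    open Type public using (pretype)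

    record Element (Γ : Context) (A : Type Γ) : Set where
      constructor element
      field
        term    : Term
        .isElem : J (term ∶ pretype A over cx Γ)
    open Element public using (term)

    mor-≡ : ∀ {Δ Γ} {f g : Mor Δ Γ} → terms f ≡ terms g → f ≡ g
    mor-≡ refl = refl

    type-≡ : ∀ {Γ} {A B : Type Γ} → pretype A ≡ pretype B → A ≡ B
    type-≡ refl = refl

    element-≅ : ∀ {Γ} {A B : Type Γ} {a : Element Γ A} {b : Element Γ B} →
                A ≡ B → term a ≡ term b → a ≅ b
    element-≅ refl refl = refl

    term-subst : ∀ {Γ} {A B : Type Γ} (e : A ≡ B) (a : Element Γ A) →
                 term (subst (Element Γ) e a) ≡ term a
    term-subst refl a = refl

    unique-OV : (Γ : Context) → Unique (varsᶜ (cx Γ))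
    unique-OV (context Γ c) = recompute (DecUnique.unique? _≟_ (varsᶜ Γ)) (OV-unique c)

    mor-inScope : ∀ {Δ Γ} (f : Mor Δ Γ) → terms f inScopeᵛ varsᶜ (cx Δ)
    mor-inScope {Δ} (morphism as m) = recompute (inScopeᵛ? as (varsᶜ (cx Δ))) (inScope-mor m)

    type-inScope : ∀ {Γ} (A : Type Γ) → pretype A inScopeᵀ varsᶜ (cx Γ)
    type-inScope {Γ} (ty A t) = recompute (inScopeᵀ? A (varsᶜ (cx Γ))) (inScope-type t)

    elem-inScope : ∀ {Γ A} (a : Element Γ A) → term a inScope varsᶜ (cx Γ)
    elem-inScope {Γ} (element a t) = recompute (inScope? a (varsᶜ (cx Γ))) (inScope-elem t)

    empty : Context
    empty = context ε emp

    idᶠ : ∀ {Γ} → Mor Γ Γ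
    idᶠ {context Γ c} = morphism (Vec.map var (OV Γ)) (id-mor c)

    infixr 9 _∘ᶠ_
    _∘ᶠ_ : ∀ {Θ Δ Γ} → Mor Δ Γ → Mor Θ Δ → Mor Θ Γ
    _∘ᶠ_ {Δ = Δ} (morphism as m) (morphism bs n) =
      morphism (Vec.map (_⟨ bs / OV (cx Δ) ⟩) as) (subst-mor n m)

    infixl 10 _[_]ᵀ _[_]ᵉ
    _[_]ᵀ : ∀ {Δ Γ} → Type Γ → Mor Δ Γ → Type Δ
    _[_]ᵀ {Γ = Γ} (ty A t) (morphism as m) = ty (A ⟨ as / OV (cx Γ) ⟩ᵀ) (subst-type m t)

    _[_]ᵉ : ∀ {Δ Γ A} → Element Γ A → (f : Mor Δ Γ) → Element Δ (A [ f ]ᵀ)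
    _[_]ᵉ {Γ = Γ} (element a t) (morphism as m) = element (a ⟨ as / OV (cx Γ) ⟩) (subst-elem m t)

    -- ⟨Γ, x : A⟩ for an arbitrary x in Fresh(Γ), and the morphism 𝐩_Γ(x : A).
    extend : (Γ : Context) (x : V) → .(Fresh (cx Γ) x) → Type Γ → Context
    extend (context Γ c) x x# (ty A t) = context (Γ ▸ x ∶ A) (ext c t x#)

    proj : ∀ {Γ x} .(x# : Fresh (cx Γ) x) (A : Type Γ) → Mor (extend Γ x x# A) Γ
    proj {context Γ c} x# (ty A t) = morphism (Vec.map var (OV Γ)) (p-mor (ext c t x#))

    infixl 8 _▷ᶠ_
    _▷ᶠ_ : (Γ : Context) → Type Γ → Context
    Γ ▷ᶠ A = extend Γ (fresh (cx Γ)) (fr∈φ (varsᶜ (cx Γ))) A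

    pᶠ : ∀ {Γ} (A : Type Γ) → Mor (Γ ▷ᶠ A) Γ
    pᶠ {Γ} = proj (fr∈φ (varsᶜ (cx Γ)))

    vᶠ : ∀ {Γ} (A : Type Γ) → Element (Γ ▷ᶠ A) (A [ pᶠ A ]ᵀ)
    vᶠ {context Γ c} (ty A t) =
      element (var (fresh Γ)) (v-elem (ext c t (fr∈φ (varsᶜ Γ))))

    pairᶠ : ∀ {Δ Γ} (A : Type Γ) (f : Mor Δ Γ) → Element Δ (A [ f ]ᵀ) → Mor Δ (Γ ▷ᶠ A)
    pairᶠ {context Δ d} {context Γ c} (ty A t) (morphism as m) (element a u) =
      morphism (as ∷ʳ a) (pair-mor (ext c t (fr∈φ (varsᶜ Γ))) m u)

    𝓕 : Cwf 0ℓ 0ℓ 0ℓ 0ℓ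
    𝓕 = record
      { Ob        = Context
      ; Hom       = Mor
      ; id        = idᶠ
      ; _∘_       = _∘ᶠ_
      ; identityˡ = λ {Δ} {Γ} f → mor-≡ (substVar-OV (OV (cx Γ)) (terms f) (unique-OV Γ))
      ; identityʳ = λ f → mor-≡ (subst-idᵛ (terms f))
      ; assoc     = λ f g k → mor-≡ (subst-∘ᵛ (terms f) (mor-inScope f))
      ; ◆         = empty
      ; !         = λ { (context Γ c) → morphism [] (mor c emp []) }
      ; !-unique  = λ { (morphism [] m) → refl }
      ; Ty        = Type
      ; _[_]T     = _[_]ᵀ
      ; [id]T     = λ A → type-≡ (subst-idᵀ (pretype A))
      ; [∘]T      = [∘]ᵀ
      ; Tm        = Element
      ; _[_]t     = _[_]ᵉ
      ; [id]t     = λ {Γ} {A} a → element-≅ (type-≡ (subst-idᵀ (pretype A))) (subst-id (term a))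
      ; [∘]t      = λ {A = A} a f g → element-≅ ([∘]ᵀ A f g) (sym (subst-∘ (term a) (elem-inScope a)))
      ; _▷_       = _▷ᶠ_
      ; p         = pᶠ
      ; v         = vᶠ
      ; ⟨_∣_,_⟩   = pairᶠ
      ; p-β       = p-βᶠ
      ; v-β       = λ {Δ} {Γ} A f a → element-≅
                      (trans (sym ([∘]ᵀ A (pᶠ A) (pairᶠ A f a))) (cong (A [_]ᵀ) (p-βᶠ A f a)))
                      (substVar-last (OV (cx Γ)) (terms f) (φ-fresh (fr∈φ (varsᶜ (cx Γ)))))
      ; pair-η    = λ {Δ} {Γ} A k → mor-≡ (trans
                      (cong (_ ∷ʳ_) (term-subst (sym ([∘]ᵀ A (pᶠ A) k)) (vᶠ A [ k ]ᵉ)))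
                      (trans (sym (map-∷ʳ _ _ (Vec.map var (OV (cx Γ)))))
                      (trans (cong (Vec.map _) (sym (map-∷ʳ var _ (OV (cx Γ)))))
                        (substVar-OV (OV (cx (Γ ▷ᶠ A))) (terms k) (unique-OV (Γ ▷ᶠ A))))))
      ; pair-∘    = λ A f a g → mor-≡ (trans (map-∷ʳ _ _ (terms f))
                      (cong (_ ∷ʳ_) (sym (term-subst (sym ([∘]ᵀ A f g)) (a [ g ]ᵉ)))))
      }
      where
      [∘]ᵀ : ∀ {Θ Δ Γ} (A : Type Γ) (f : Mor Δ Γ) (g : Mor Θ Δ) →
             A [ f ∘ᶠ g ]ᵀ ≡ A [ f ]ᵀ [ g ]ᵀ
      [∘]ᵀ A f g = type-≡ (sym (subst-∘ᵀ (pretype A) (type-inScope A)))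

      p-βᶠ : ∀ {Δ Γ} (A : Type Γ) (f : Mor Δ Γ) (a : Element Δ (A [ f ]ᵀ)) →
             pᶠ A ∘ᶠ pairᶠ A f a ≡ f
      p-βᶠ {Δ} {Γ} A f a = mor-≡ (substVar-p (OV (cx Γ)) (terms f) (unique-OV Γ))

  data Connective : Set where
    and or imp : Connective

  data Quantifier : Set where
    all ex : Quantifier

  module Logic (Sg : Signature) (P : Set) where
    open Signature Sg
    open Contexts Sg

    data PredicateDeclaration : Set where
      predDecl : (Γ : Cx) (is : Indices Γ) (R : P) → PredicateDeclaration

    predicate : PredicateDeclaration → P
    predicate (predDecl Γ is R) = R

    WellFormedᴾ : PredicateDeclaration → Set
    WellFormedᴾ (predDecl Γ is R) = J (Γ ctx) × Determining Γ is

    OnStandardFormᴾ : PredicateDeclaration → Set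
    OnStandardFormᴾ (predDecl Γ is R) = is ≡ allFin ∣ Γ ∣

    record PredicateSignature : Set₁ where
      field
        declaresᴾ   : Pred PredicateDeclaration 0ℓ
        wellFormedᴾ : ∀ {d} → declaresᴾ d → WellFormedᴾ d
        uniqueᴾ     : ∀ {d d′} → declaresᴾ d → declaresᴾ d′ →
                      predicate d ≡ predicate d′ → d ≡ d′

    StandardFormᴾ : PredicateSignature → Set
    StandardFormᴾ Π = ∀ {d} → declaresᴾ d → OnStandardFormᴾ d
      where open PredicateSignature Π

    data Formula : Set where
      atom   : P → List Term → Formula
      ⊤ᶠ ⊥ᶠ : Formula
      conn   : Connective → Formula → Formula → Formula
      quant  : Quantifier → V → Pretype → Formula → Formula

    -- φ{(Δ, Γ, ā)}; a bound variable is renamed to the fresh variable of the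
    -- context it is moved to.
    substF : (Δ Γ : Cx) → Vec Term ∣ Γ ∣ → Formula → Formula
    substF Δ Γ as (atom R ts)     = atom R (ts ⟨ as / OV Γ ⟩*)
    substF Δ Γ as ⊤ᶠ              = ⊤ᶠ
    substF Δ Γ as ⊥ᶠ              = ⊥ᶠ
    substF Δ Γ as (conn ∗ φ ψ)    = conn ∗ (substF Δ Γ as φ) (substF Δ Γ as ψ)
    substF Δ Γ as (quant Q x A θ) =
      quant Q y (A ⟨ as / OV Γ ⟩ᵀ)
        (substF (Δ ▸ y ∶ A ⟨ as / OV Γ ⟩ᵀ) (Γ ▸ x ∶ A) (as ∷ʳ var y) θ)
      where
      y : V
      y = fresh Δ

    module Theories (Π : PredicateSignature) where
      open PredicateSignature Π

      infix 3 _form_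

      data _form_ : Formula → Cx → Set where
        atom  : ∀ {Γ is R Δ as} → declaresᴾ (predDecl Γ is R) → Δ ⟶ Γ ∋ as →
                atom R (as ‼ is) form Δ
        ⊤ᶠ    : ∀ {Γ} → J (Γ ctx) → ⊤ᶠ form Γ
        ⊥ᶠ    : ∀ {Γ} → J (Γ ctx) → ⊥ᶠ form Γ
        conn  : ∀ {Γ φ ψ} ∗ → φ form Γ → ψ form Γ → conn ∗ φ ψ form Γ
        quant : ∀ {Γ x A φ} Q → J (A type Γ) → φ form (Γ ▸ x ∶ A) → quant Q x A φ form Γ

      form-ctx : ∀ {φ Γ} → φ form Γ → J (Γ ctx)
      form-ctx (atom d m)    = dom m
      form-ctx (⊤ᶠ c)        = c
      form-ctx (⊥ᶠ c)        = c
      form-ctx (conn ∗ f g)  = form-ctx f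
      form-ctx (quant Q t f) with form-ctx f
      ... | ext c _ _ = c

      subst-form : ∀ {Δ Γ as φ} → Δ ⟶ Γ ∋ as → φ form Γ → substF Δ Γ as φ form Δ
      subst-form {Δ} m (atom {is = is} {as = bs} d n) =
        subst (λ ts → atom _ ts form Δ) (sym (subst-‼ bs is)) (atom d (subst-mor m n))
      subst-form m (⊤ᶠ c)        = ⊤ᶠ (dom m)
      subst-form m (⊥ᶠ c)        = ⊥ᶠ (dom m)
      subst-form m (conn ∗ f g)  = conn ∗ (subst-form m f) (subst-form m g)
      subst-form m (quant Q t f) =
        quant Q (subst-type m t) (subst-form (lift-mor m (form-ctx f)) f)

      record Fm (Γ : Context) : Set where
        constructor formula
        field
          fml     : Formula
          .isForm : fml form cx Γ
      open Fm public using (fml)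

      infixl 10 _[_]ᶠ
      _[_]ᶠ : ∀ {Δ Γ} → Fm Γ → Mor Δ Γ → Fm Δ
      _[_]ᶠ {Δ} {Γ} (formula φ f) (morphism as m) =
        formula (substF (cx Δ) (cx Γ) as φ) (subst-form m f)

      ⊤ᴾ ⊥ᴾ : ∀ {Γ} → Fm Γ
      ⊤ᴾ {context Γ c} = formula ⊤ᶠ (⊤ᶠ c)
      ⊥ᴾ {context Γ c} = formula ⊥ᶠ (⊥ᶠ c)

      connᴾ : ∀ {Γ} → Connective → Fm Γ → Fm Γ → Fm Γ
      connᴾ ∗ (formula φ f) (formula ψ g) = formula (conn ∗ φ ψ) (conn ∗ f g)

      infixr 7 _∧ᴾ_
      infixr 6 _∨ᴾ_
      infixr 5 _⇒ᴾ_
      _∧ᴾ_ _∨ᴾ_ _⇒ᴾ_ : ∀ {Γ} → Fm Γ → Fm Γ → Fm Γ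
      _∧ᴾ_ = connᴾ and
      _∨ᴾ_ = connᴾ or
      _⇒ᴾ_ = connᴾ imp

      quantᴾ : ∀ {Γ} → Quantifier → (x : V) .(x# : Fresh (cx Γ) x) (A : Type Γ) →
               Fm (extend Γ x x# A) → Fm Γ
      quantᴾ Q x x# (ty A t) (formula φ f) = formula (quant Q x A φ) (quant Q t f)

      ∀ᴾ ∃ᴾ : ∀ {Γ} (A : Type Γ) → Fm (Γ ▷ᶠ A) → Fm Γ
      ∀ᴾ {Γ} A = quantᴾ all (fresh (cx Γ)) (fr∈φ (varsᶜ (cx Γ))) A
      ∃ᴾ {Γ} A = quantᴾ ex  (fresh (cx Γ)) (fr∈φ (varsᶜ (cx Γ))) A

      -- A set of sequents: 𝒯 Γ φ ψ stands for (φ ⇒_Γ ψ) ∈ 𝒯.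
      Theory : Set₁
      Theory = (Γ : Context) → Fm Γ → Fm Γ → Set

      ∅ : Theory
      ∅ Γ φ ψ = ⊥

      data Thm (𝒯 : Theory) : Theory where
        axiom : ∀ {Γ φ ψ} → 𝒯 Γ φ ψ → Thm 𝒯 Γ φ ψ
        ident : ∀ {Γ φ} → Thm 𝒯 Γ φ φ
        cut   : ∀ {Γ φ ψ θ} → Thm 𝒯 Γ φ ψ → Thm 𝒯 Γ ψ θ → Thm 𝒯 Γ φ θ
        ∧-l   : ∀ {Γ θ ψ} → Thm 𝒯 Γ (θ ∧ᴾ ψ) θ
        ∧-r   : ∀ {Γ θ ψ} → Thm 𝒯 Γ (θ ∧ᴾ ψ) ψ
        ∧-in  : ∀ {Γ φ θ ψ} → Thm 𝒯 Γ φ θ → Thm 𝒯 Γ φ ψ → Thm 𝒯 Γ φ (θ ∧ᴾ ψ)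
        ⊤-in  : ∀ {Γ φ} → Thm 𝒯 Γ φ ⊤ᴾ
        ∨-l   : ∀ {Γ θ ψ} → Thm 𝒯 Γ θ (θ ∨ᴾ ψ)
        ∨-r   : ∀ {Γ θ ψ} → Thm 𝒯 Γ ψ (θ ∨ᴾ ψ)
        ∨-out : ∀ {Γ θ ψ φ} → Thm 𝒯 Γ θ φ → Thm 𝒯 Γ ψ φ → Thm 𝒯 Γ (θ ∨ᴾ ψ) φ
        ⊥-out : ∀ {Γ φ} → Thm 𝒯 Γ ⊥ᴾ φ
        ⇒-in  : ∀ {Γ θ ψ φ} → Thm 𝒯 Γ (θ ∧ᴾ ψ) φ → Thm 𝒯 Γ θ (ψ ⇒ᴾ φ)
        ⇒-out : ∀ {Γ θ ψ φ} → Thm 𝒯 Γ θ (ψ ⇒ᴾ φ) → Thm 𝒯 Γ (θ ∧ᴾ ψ) φ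
        ∀-in  : ∀ {Γ x A φ} (x# : Fresh (cx Γ) x) {ψ : Fm (extend Γ x x# A)} →
                Thm 𝒯 (extend Γ x x# A) (φ [ proj x# A ]ᶠ) ψ → Thm 𝒯 Γ φ (quantᴾ all x x# A ψ)
        ∀-out : ∀ {Γ x A φ} (x# : Fresh (cx Γ) x) {ψ : Fm (extend Γ x x# A)} →
                Thm 𝒯 Γ φ (quantᴾ all x x# A ψ) → Thm 𝒯 (extend Γ x x# A) (φ [ proj x# A ]ᶠ) ψ
        ∃-in  : ∀ {Γ x A φ} (x# : Fresh (cx Γ) x) {ψ : Fm (extend Γ x x# A)} →
                Thm 𝒯 Γ (quantᴾ ex x x# A ψ) φ → Thm 𝒯 (extend Γ x x# A) ψ (φ [ proj x# A ]ᶠ)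
        ∃-out : ∀ {Γ x A φ} (x# : Fresh (cx Γ) x) {ψ : Fm (extend Γ x x# A)} →
                Thm 𝒯 (extend Γ x x# A) ψ (φ [ proj x# A ]ᶠ) → Thm 𝒯 Γ (quantᴾ ex x x# A ψ) φ
        sub   : ∀ {Δ Γ φ ψ} (f : Mor Δ Γ) → Thm 𝒯 Γ φ ψ → Thm 𝒯 Δ (φ [ f ]ᶠ) (ψ [ f ]ᶠ)

      WellScoped : Cx → Formula → Set
      WellScoped Γ (atom R ts)     = ts inScope* varsᶜ Γ
      WellScoped Γ ⊤ᶠ              = ⊤
      WellScoped Γ ⊥ᶠ              = ⊤
      WellScoped Γ (conn ∗ φ ψ)    = WellScoped Γ φ × WellScoped Γ ψ
      WellScoped Γ (quant Q x A φ) =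
        A inScopeᵀ varsᶜ Γ × x ≡ fresh Γ × WellScoped (Γ ▸ x ∶ A) φ

      wellScoped? : ∀ Γ φ → Dec (WellScoped Γ φ)
      wellScoped? Γ (atom R ts)     = All.all? (_∈? varsᶜ Γ) (vars* ts)
      wellScoped? Γ ⊤ᶠ              = yes tt
      wellScoped? Γ ⊥ᶠ              = yes tt
      wellScoped? Γ (conn ∗ φ ψ)    = wellScoped? Γ φ ×-dec wellScoped? Γ ψ
      wellScoped? Γ (quant Q x A φ) =
        inScopeᵀ? A (varsᶜ Γ) ×-dec (x ≟ fresh Γ ×-dec wellScoped? (Γ ▸ x ∶ A) φ)

      substF-id : ∀ {Γ} φ → WellScoped Γ φ → substF Γ Γ (Vec.map var (OV Γ)) φ ≡ φ
      substF-id (atom R ts)  s       = cong (atom R) (subst-id* ts)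
      substF-id ⊤ᶠ           s       = refl
      substF-id ⊥ᶠ           s       = refl
      substF-id (conn ∗ φ ψ) (s , r) = cong₂ (conn ∗) (substF-id φ s) (substF-id ψ r)
      substF-id {Γ} (quant Q x A φ) (a , refl , s)
        rewrite subst-idᵀ {xs = OV Γ} A =
        cong (quant Q x A) (trans
          (cong (λ as → substF (Γ ▸ x ∶ A) (Γ ▸ x ∶ A) as φ) (sym (map-∷ʳ var x (OV Γ))))
          (substF-id φ s))

      substF-∘ : ∀ {Θ Δ Γ} {as : Vec Term ∣ Γ ∣} {bs : Vec Term ∣ Δ ∣} φ →
                 WellScoped Γ φ → as inScopeᵛ varsᶜ Δ →
                 substF Θ Γ (Vec.map (_⟨ bs / OV Δ ⟩) as) φ ≡ substF Θ Δ bs (substF Δ Γ as φ)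
      substF-∘ (atom R ts)  s       r = cong (atom R) (sym (subst-∘* ts s))
      substF-∘ ⊤ᶠ           s       r = refl
      substF-∘ ⊥ᶠ           s       r = refl
      substF-∘ (conn ∗ φ ψ) (s , t) r = cong₂ (conn ∗) (substF-∘ φ s r) (substF-∘ ψ t r)
      substF-∘ {Θ} {Δ} {Γ} {as} {bs} (quant Q x A φ) (a , _ , s) r
        rewrite sym (subst-∘ᵀ {as = as} {OV Γ} {bs} {OV Δ} A a) =
        cong (quant Q z B) (trans (cong (λ cs → substF (Θ ▸ z ∶ B) (Γ ▸ x ∶ A) cs φ) (sym eq))
          (substF-∘ φ s (VAll-∷ʳ (VAllₘ.map (All.map (∈-∷ʳ⁺ˡ (OV Δ) y)) r) (∈-∷ʳ⁺ʳ (OV Δ) y ∷ []))))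
        where
        y z : V
        y = fresh Δ
        z = fresh Θ
        B : Pretype
        B = A ⟨ as / OV Γ ⟩ᵀ ⟨ bs / OV Δ ⟩ᵀ
        eq : Vec.map (_⟨ bs ∷ʳ var z / OV Δ ∷ʳ y ⟩) (as ∷ʳ var y)
             ≡ Vec.map (_⟨ bs / OV Δ ⟩) as ∷ʳ var z
        eq = trans (map-∷ʳ _ (var y) as) (cong₂ _∷ʳ_
               (map-congᵛ (λ {t} → subst-∷ʳ t) r)
               (substVar-last (OV Δ) bs (φ-fresh (fr∈φ (varsᶜ Δ)))))

      -- The Lindenbaum–Tarski hyperdoctrine.  The de Bruijn property is needed
      -- for the identity morphisms to act as identities on formulas.
      module _ (db : DeBruijn 𝕍) where

        form-scoped : ∀ {φ Γ} → φ form Γ → WellScoped Γ φ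
        form-scoped (atom {is = is} d m) = inScopeᵛ-‼ (inScope-mor m) is
        form-scoped (⊤ᶠ c)        = tt
        form-scoped (⊥ᶠ c)        = tt
        form-scoped (conn ∗ f g)  = form-scoped f , form-scoped g
        form-scoped (quant Q t f) with form-ctx f
        ... | ext _ _ x# = inScope-type t , db x# , form-scoped f

        private
          fm-≡ : ∀ {Γ} {φ ψ : Fm Γ} → fml φ ≡ fml ψ → φ ≡ ψ
          fm-≡ refl = refl

          fm-scoped : ∀ {Γ} (φ : Fm Γ) → WellScoped (cx Γ) (fml φ)
          fm-scoped {Γ} (formula φ f) = recompute (wellScoped? (cx Γ) φ) (form-scoped f)

        LindenbaumTarski : Theory → Context → Heyting 0ℓ 0ℓ
        LindenbaumTarski 𝒯 Γ = record
          { Carrier    = Fm Γ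
          ; _≤_        = Thm 𝒯 Γ
          ; isPreorder = record
              { isEquivalence = isEquivalence
              ; reflexive     = λ { refl → ident }
              ; trans         = cut
              }
          ; ⊤′    = ⊤ᴾ
          ; ⊥′    = ⊥ᴾ
          ; _∧_   = _∧ᴾ_
          ; _∨_   = _∨ᴾ_
          ; _⇒_   = _⇒ᴾ_
          ; ⊥-min = λ φ → ⊥-out
          ; ⊤-max = λ φ → ⊤-in
          ; ∧-glb = λ φ ψ θ → mk⇔ (λ d → cut d (∧-l {θ = φ} {ψ}) , cut d (∧-r {θ = φ} {ψ})) (λ (d , e) → ∧-in d e)
          ; ∨-lub = λ φ ψ θ → mk⇔ (λ d → cut (∨-l {θ = φ} {ψ}) d , cut (∨-r {θ = φ} {ψ}) d) (λ (d , e) → ∨-out d e)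
          ; ⇒-adj = λ φ ψ θ → mk⇔ (⇒-out {θ = θ} {φ} {ψ}) (⇒-in {θ = θ} {φ} {ψ})
          }

        𝓗 : Theory → Hyperdoctrine 𝓕 0ℓ 0ℓ
        𝓗 𝒯 = record
          { Pr      = LindenbaumTarski 𝒯
          ; _[_]P   = _[_]ᶠ
          ; []P-mor = λ f → record
              { monotone = sub f
              ; pres-⊤   = refl
              ; pres-⊥   = refl
              ; pres-∧   = λ _ _ → refl
              ; pres-∨   = λ _ _ → refl
              ; pres-⇒   = λ _ _ → refl
              }
          ; [id]P   = λ φ → fm-≡ (substF-id (fml φ) (fm-scoped φ))
          ; [∘]P    = λ φ f g → fm-≡ (substF-∘ (fml φ) (fm-scoped φ) (mor-inScope f))
          ; ∀′      = ∀ᴾ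
          ; ∃′      = ∃ᴾ
          ; ∀-mono  = λ A d → ∀-in′ A (cut (∀-out′ A ident) d)
          ; ∃-mono  = λ A d → ∃-out′ A (cut d (∃-in′ A ident))
          ; ∀-adj   = λ A φ ψ → mk⇔ (∀-out′ A) (∀-in′ A)
          ; ∃-adj   = λ A φ ψ → mk⇔ (∃-in′ A) (∃-out′ A)
          ; ∀-[]    = λ A φ f → fm-≡ (quant-[] all A φ f)
          ; ∃-[]    = λ A φ f → fm-≡ (quant-[] ex A φ f)
          }
          where
          open Cwf 𝓕 using (_↑_)

          ∀-in′ : ∀ {Γ} (A : Type Γ) {φ ψ} → Thm 𝒯 (Γ ▷ᶠ A) (φ [ pᶠ A ]ᶠ) ψ → Thm 𝒯 Γ φ (∀ᴾ A ψ)
          ∀-in′ A {φ} {ψ} = ∀-in {A = A} {φ} (fr∈φ _) {ψ}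

          ∀-out′ : ∀ {Γ} (A : Type Γ) {φ ψ} → Thm 𝒯 Γ φ (∀ᴾ A ψ) → Thm 𝒯 (Γ ▷ᶠ A) (φ [ pᶠ A ]ᶠ) ψ
          ∀-out′ A {φ} {ψ} = ∀-out {A = A} {φ} (fr∈φ _) {ψ}

          ∃-in′ : ∀ {Γ} (A : Type Γ) {φ ψ} → Thm 𝒯 Γ (∃ᴾ A ψ) φ → Thm 𝒯 (Γ ▷ᶠ A) ψ (φ [ pᶠ A ]ᶠ)
          ∃-in′ A {φ} {ψ} = ∃-in {A = A} {φ} (fr∈φ _) {ψ}

          ∃-out′ : ∀ {Γ} (A : Type Γ) {φ ψ} → Thm 𝒯 (Γ ▷ᶠ A) ψ (φ [ pᶠ A ]ᶠ) → Thm 𝒯 Γ (∃ᴾ A ψ) φ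
          ∃-out′ A {φ} {ψ} = ∃-out {A = A} {φ} (fr∈φ _) {ψ}

          quant-[] : ∀ {Δ Γ} Q (A : Type Γ) φ (f : Mor Δ Γ) →
                     fml (quantᴾ Q (fresh (cx Γ)) (fr∈φ _) A φ [ f ]ᶠ) ≡
                     fml (quantᴾ Q (fresh (cx Δ)) (fr∈φ _) (A [ f ]ᵀ) (φ [ f ↑ A ]ᶠ))
          quant-[] {Δ} {Γ} Q A φ f = cong (quant Q _ _)
            (cong (λ as → substF (cx (Δ ▷ᶠ A [ f ]ᵀ)) (cx (Γ ▷ᶠ A)) as (fml φ)) eq)
            where
            eq : terms f ∷ʳ var (fresh (cx Δ)) ≡ terms (f ↑ A)
            eq = sym (cong₂ _∷ʳ_ (subst-idᵛ (terms f))
                   (term-subst (sym (Cwf.[∘]T 𝓕 A f (pᶠ (A [ f ]ᵀ)))) (vᶠ (A [ f ]ᵀ))))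

{-# OPTIONS --safe #-}
-- Soundness by induction on derivations.  Every rule other than the axioms
-- holds in 𝒟: the propositional rules are the Heyting algebra laws, the
-- substitution rule is monotonicity of reindexing, and the quantifier rules are
-- the adjunctions along 𝐩.  A rule may bind any fresh variable, but by the
-- de Bruijn property this is the one used in Γ ▷ A.
module Submission where

open import Data.Product.Base using (_×_; _,_; proj₁; proj₂)
open import Function.Bundles using (_⇔_; module Equivalence)
open import Level using (Level)
open import Relation.Binary.HeterogeneousEquality using (_≅_; refl)
open import Relation.Binary.PropositionalEquality using (_≡_; refl; subst)
open import Relation.Binary.Structures using (IsPreorder)
open import Defs

open Equivalence using (to; from)

module _ {o h t m c ℓ : Level} {𝒞 : Cwf o h t m} (𝒟 : Hyperdoctrine 𝒞 c ℓ) where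
  open Cwf 𝒞
  open Hyperdoctrine 𝒟

  -- A cwf morphism preserves context extension and `p` only up to an equality that cannot be
  -- matched on, as `F₀ (Γ ▷ S)` is not a variable. With `Δ` and `f` general, both equations can be
  -- matched with `refl`.
  ∀-adj-transport : ∀ {Γ Δ} (S : Ty Γ) (e : Δ ≡ Γ ▷ S) {f : Hom Δ Γ} → f ≅ p S →
                    ∀ Q R → Q ≤ ∀′ S (subst ∣Pr∣ e R) ⇔ Q [ f ]P ≤ R
  ∀-adj-transport S refl refl = ∀-adj S

  ∃-adj-transport : ∀ {Γ Δ} (S : Ty Γ) (e : Δ ≡ Γ ▷ S) {f : Hom Δ Γ} → f ≅ p S →
                    ∀ Q R → ∃′ S (subst ∣Pr∣ e R) ≤ Q ⇔ R ≤ Q [ f ]P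
  ∃-adj-transport S refl refl = ∃-adj S

module _ {o h t m o′ h′ t′ m′ c ℓ c′ ℓ′ : Level}
         {𝒞 : Cwf o h t m} {𝒞′ : Cwf o′ h′ t′ m′} (𝐅 : CwfMorphism 𝒞 𝒞′)
         (ℋ : Hyperdoctrine 𝒞 c ℓ) (ℋ′ : Hyperdoctrine 𝒞′ c′ ℓ′)
         (𝐆 : HyperdoctrineMorphism 𝐅 ℋ ℋ′) where
  private
    module C = Cwf 𝒞
    module F = CwfMorphism 𝐅
    module H = Hyperdoctrine ℋ
    module K = Hyperdoctrine ℋ′
  open HyperdoctrineMorphism 𝐆
  open IsHyperdoctrineMorphism isMorphism

  -- `pres-∀` and `natural` turn the two inequalities into the adjunction of `ℋ′` along `F₁ (p S)`,
  -- which `F-p` identifies with the projection of `σ S`.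
  image-∀-adj : ∀ {Γ} (S : C.Ty Γ) Q R →
                G Γ Q K.≤ G Γ (H.∀′ S R) ⇔ G (Γ C.▷ S) (Q H.[ C.p S ]P) K.≤ G (Γ C.▷ S) R
  image-∀-adj S Q R rewrite pres-∀ S R | natural Q (C.p S) =
    ∀-adj-transport ℋ′ (F.σ S) (F.F-▷ S) (F.F-p S) _ _

  image-∃-adj : ∀ {Γ} (S : C.Ty Γ) Q R →
                G Γ (H.∃′ S R) K.≤ G Γ Q ⇔ G (Γ C.▷ S) R K.≤ G (Γ C.▷ S) (Q H.[ C.p S ]P)
  image-∃-adj S Q R rewrite pres-∃ S R | natural Q (C.p S) =
    ∃-adj-transport ℋ′ (F.σ S) (F.F-▷ S) (F.F-p S) _ _

  image-[]-mono : ∀ {Δ Γ} (f : C.Hom Δ Γ) {Q R} → G Γ Q K.≤ G Γ R →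
                  G Δ (Q H.[ f ]P) K.≤ G Δ (R H.[ f ]P)
  image-[]-mono f {Q} {R} d rewrite natural Q f | natural R f =
    IsHeytingMorphism.monotone (K.[]P-mor (F.F₁ f)) d

mainTheorem20 : ∀ {o h t m c ℓ : Level} (𝕍 : VariableSystem) (db : DeBruijn 𝕍) (F T P : Set) →
    let open Syntax 𝕍 F T in
    (Sg : Signature) → StandardForm Sg →
    let open Contexts Sg in let open Logic Sg P in
    (𝒞 : Cwf o h t m) (𝐅 : CwfMorphism 𝓕 𝒞)
    (Π : PredicateSignature) → StandardFormᴾ Π →
    let open Theories Π in
    (𝒟 : Hyperdoctrine 𝒞 c ℓ) (𝐆 : HyperdoctrineMorphism 𝐅 (𝓗 db ∅) 𝒟) →
    let open HyperdoctrineMorphism 𝐆 using (G) in let open Hyperdoctrine 𝒟 using (_≤_) in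
    (𝒯 : Theory) →
    (∀ Γ φ ψ → 𝒯 Γ φ ψ → G Γ φ ≤ G Γ ψ) →
    (∀ Γ φ ψ → Thm 𝒯 Γ φ ψ → G Γ φ ≤ G Γ ψ)
    × IsHyperdoctrineMorphism 𝐅 (𝓗 db 𝒯) 𝒟 G
mainTheorem20 𝕍 db F T P Sg _ 𝒞 𝐅 Π _ 𝒟 𝐆 𝒯 valid = (λ Γ φ ψ → sound) , record
  { heyting = λ Γ → let open IsHeytingMorphism (heyting Γ) in record
      -- Carriers, operations, reindexing and quantifiers of `𝓗` do not depend on the theory; only
      -- the order does. So all fields but this one carry over.
      { monotone = sound
      ; pres-⊤   = pres-⊤
      ; pres-⊥   = pres-⊥
      ; pres-∧   = pres-∧
      ; pres-∨   = pres-∨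
      ; pres-⇒   = pres-⇒
      }
  ; natural = natural
  ; pres-∀  = pres-∀
  ; pres-∃  = pres-∃
  }
  where
  open Syntax 𝕍 F T
  open Contexts Sg
  open Logic Sg P
  open Theories Π
  open HyperdoctrineMorphism 𝐆
  open IsHyperdoctrineMorphism isMorphism
  open Hyperdoctrine 𝒟 using (Pr; _≤_)

  module K Γ = Heyting (Pr (CwfMorphism.F₀ 𝐅 Γ))
  module K≤ Γ = IsPreorder (K.isPreorder Γ)
  module M Γ = IsHeytingMorphism (heyting Γ)

  sound : ∀ {Γ φ ψ} → Thm 𝒯 Γ φ ψ → G Γ φ ≤ G Γ ψ
  sound {Γ} (axiom d) = valid Γ _ _ d
  sound {Γ} ident     = K≤.refl Γ
  sound {Γ} (cut d e) = K≤.trans Γ (sound d) (sound e)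
  -- Once `G` is moved inside the connective, both projections come from the universal property at
  -- reflexivity.
  sound {Γ} (∧-l {θ = θ} {ψ}) rewrite M.pres-∧ Γ θ ψ = proj₁ (to (K.∧-glb Γ _ _ _) (K≤.refl Γ))
  sound {Γ} (∧-r {θ = θ} {ψ}) rewrite M.pres-∧ Γ θ ψ = proj₂ (to (K.∧-glb Γ _ _ _) (K≤.refl Γ))
  sound {Γ} (∧-in {θ = θ} {ψ} d e) rewrite M.pres-∧ Γ θ ψ = from (K.∧-glb Γ _ _ _) (sound d , sound e)
  sound {Γ} ⊤-in rewrite M.pres-⊤ Γ = K.⊤-max Γ _
  sound {Γ} (∨-l {θ = θ} {ψ}) rewrite M.pres-∨ Γ θ ψ = proj₁ (to (K.∨-lub Γ _ _ _) (K≤.refl Γ))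
  sound {Γ} (∨-r {θ = θ} {ψ}) rewrite M.pres-∨ Γ θ ψ = proj₂ (to (K.∨-lub Γ _ _ _) (K≤.refl Γ))
  sound {Γ} (∨-out {θ = θ} {ψ} d e) rewrite M.pres-∨ Γ θ ψ = from (K.∨-lub Γ _ _ _) (sound d , sound e)
  sound {Γ} ⊥-out rewrite M.pres-⊥ Γ = K.⊥-min Γ _
  -- `d′` is bound first so that the rewrites reach its type: `pres-∧` acts on the premise, `pres-⇒`
  -- on the goal.
  sound {Γ} (⇒-in {θ = θ} {ψ} {φ} d) with d′ ← sound d
    rewrite M.pres-∧ Γ θ ψ | M.pres-⇒ Γ ψ φ = from (K.⇒-adj Γ _ _ _) d′
  sound {Γ} (⇒-out {θ = θ} {ψ} {φ} d) with d′ ← sound d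
    rewrite M.pres-∧ Γ θ ψ | M.pres-⇒ Γ ψ φ = to (K.⇒-adj Γ _ _ _) d′
  -- Matching replaces `x` by `fresh (cx Γ)`. As `extend` takes its freshness proof irrelevantly,
  -- `extend Γ x x# A` becomes `Γ ▷ᶠ A` and `proj x# A` becomes `pᶠ A`.
  sound (∀-in {A = A} {φ} x# {ψ} d) with refl ← db x# =
    from (image-∀-adj 𝐅 (𝓗 db ∅) 𝒟 𝐆 A φ ψ) (sound d)
  sound (∀-out {A = A} {φ} x# {ψ} d) with refl ← db x# =
    to (image-∀-adj 𝐅 (𝓗 db ∅) 𝒟 𝐆 A φ ψ) (sound d)
  sound (∃-in {A = A} {φ} x# {ψ} d) with refl ← db x# =
    to (image-∃-adj 𝐅 (𝓗 db ∅) 𝒟 𝐆 A φ ψ) (sound d)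
  sound (∃-out {A = A} {φ} x# {ψ} d) with refl ← db x# =
    from (image-∃-adj 𝐅 (𝓗 db ∅) 𝒟 𝐆 A φ ψ) (sound d)
  sound (sub f d) = image-[]-mono 𝐅 (𝓗 db ∅) 𝒟 𝐆 f (sound d)
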